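{- Let $c\ge 1$ be a constant. If there exists a polynomial time grammar-based compressor $\mathcal{C}$ with $\alpha_{\mathcal{C}}(2,n)\le c$ for all $n$, then there exists a polynomial time grammar-based compressor $\mathcal{D}$ with $\alpha_{\mathcal{D}}(n)\le 6c$ for all $n$.
   Context: A straight-line program (SLP) over a finite alphabet $\Sigma$ is a context-free grammar $\mathbb{A}=(N,\Sigma,P,S)$ with a finite set $N$ of nonterminals ($N\cap\Sigma=\emptyset$), start nonterminal $S\in N$, and a finite set $P$ of productions $A\to w$ with $A\in N$, $w\in(N\cup\Sigma)^+$, such that (i) for every $A\in N$ there is exactly one production with left-hand side $A$, and (ii) the relation $\{(A,B)\in N\times N \mid (A\to w)\in P,\ B \text{ occurs in } w\}$ is acyclic. Every nonterminal $A$ produces a unique word $\mathrm{val}(A)\in\Sigma^+$, and $\mathrm{val}(\mathbb{A})=\mathrm{val}(S)$. The size of $\mathbb{A}$ is $|\mathbb{A}|=\sum_{(A\to w)\in P}|w|$. For a nonempty word $w$, $g(w)$ denotes the size of a smallest SLP producing $w$. A grammar-based compressor $\mathcal{C}$ is an algorithm that computes for each nonempty word $w$ an SLP $\mathcal{C}(w)$ with $\mathrm{val}(\mathcal{C}(w))=w$. With $[1,k]=\{1,\dots,k\}$, its worst-case approximation ratio over words of length $n$ over an alphabet of size $k$ is $$\alpha_{\mathcal{C}}(k,n)=\max\{|\mathcal{C}(w)|/g(w) \mid w\in[1,k]^n\},$$ and $\alpha_{\mathcal{C}}(n)=\alpha_{\mathcal{C}}(n,n)$ (the case of no restriction on the alphabet).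 -}

module Defs where

open import Level using (0ℓ)
open import Data.Empty using (⊥)
open import Data.Fin.Base using (Fin; toℕ)
open import Data.Fin.Induction using (spo-wellFounded)
open import Data.Integer.Base using (+_)
open import Data.List.Base using (List; []; _∷_; length; map; concat; allFin)
open import Data.List.Membership.Propositional using (_∈_; mapWith∈)
open import Data.List.NonEmpty.Base as List⁺ using (List⁺; toList)
open import Data.List.Relation.Unary.All using (All)
open import Data.Nat.Base as ℕ using (ℕ; suc)
open import Data.Nat.Binary.Base as ℕᵇ using (ℕᵇ; 2[1+_]; 1+[2_])
open import Data.Nat.ListAction using (sum)
open import Data.Product.Base using (Σ; ∃; ∃-syntax; _×_; _,_)
open import Data.Rational.Base as ℚ using (ℚ; 1ℚ; 1/_; Positive; NonZero)
open import Data.Rational.Properties as ℚ using (pos⇒nonZero; 1/pos⇒pos; *-monoˡ-<-pos; *-assoc; *-inverseˡ; *-inverseʳ; *-identityʳ)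
open import Data.Sum.Base using (_⊎_; inj₁; inj₂)
open import Data.Vec.Base using (Vec; _∷_; head; lookup; replicate; _[_]≔_)
open import Induction.WellFounded using (Acc; acc; WellFounded)
open import Relation.Binary.Construct.Closure.Transitive using (TransClosure; transitive; wellFounded⁻)
open import Relation.Binary.Core using (Rel)
open import Relation.Binary.PropositionalEquality using (_≡_; refl; sym; trans; cong; subst; isEquivalence; resp₂)
open import Relation.Nullary using (¬_)

------------------------------------------------------------------------
-- Dedekind reals

record ℝ : Set₁ where
  field
    L U       : ℚ → Set
    L-inhab   : ∃ L
    U-inhab   : ∃ U
    L-down    : ∀ {p q} → p ℚ.< q → L q → L p
    L-open    : ∀ {p} → L p → ∃[ q ] p ℚ.< q × L q
    U-up      : ∀ {p q} → p ℚ.< q → U p → U q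
    U-open    : ∀ {q} → U q → ∃[ p ] p ℚ.< q × U p
    disjoint  : ∀ {q} → L q → U q → ⊥
    located   : ∀ {p q} → p ℚ.< q → L p ⊎ U q

-- U x q means x < q, and q ≤ x is its negation.
infix 4 _≤ʳ_
_≤ʳ_ : ℚ → ℝ → Set
q ≤ʳ x = ¬ ℝ.U x q

infixl 7 _·_
_·_ : (r : ℚ) .{{_ : Positive r}} → ℝ → ℝ
r · x = record
  { L        = λ q → L (q ℚ.* s)
  ; U        = λ q → U (q ℚ.* s)
  ; L-inhab  = let (q , l) = L-inhab in q ℚ.* r , subst L (sym (undo q)) l
  ; U-inhab  = let (q , u) = U-inhab in q ℚ.* r , subst U (sym (undo q)) u
  ; L-down   = λ p<q → L-down (*-monoˡ-<-pos s p<q)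
  ; L-open   = λ {p} l → let (q , p<q , l′) = L-open l in
                 q ℚ.* r , subst (ℚ._< (q ℚ.* r)) (redo p) (*-monoˡ-<-pos r p<q)
                         , subst L (sym (undo q)) l′
  ; U-up     = λ p<q → U-up (*-monoˡ-<-pos s p<q)
  ; U-open   = λ {q} u → let (p , p<q , u′) = U-open u in
                 p ℚ.* r , subst (p ℚ.* r ℚ.<_) (redo q) (*-monoˡ-<-pos r p<q)
                         , subst U (sym (undo p)) u′
  ; disjoint = disjoint
  ; located  = λ p<q → located (*-monoˡ-<-pos s p<q)
  }
  where
  open ℝ x
  instance
    r≢0 : NonZero r
    r≢0 = pos⇒nonZero r
  s : ℚ
  s = 1/ r
  instance
    s>0 : Positive s
    s>0 = 1/pos⇒pos r
  undo : ∀ q → q ℚ.* r ℚ.* s ≡ q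
  undo q = trans (*-assoc q r s) (trans (cong (q ℚ.*_) (*-inverseʳ r)) (*-identityʳ q))
  redo : ∀ q → q ℚ.* s ℚ.* r ≡ q
  redo q = trans (*-assoc q s r) (trans (cong (q ℚ.*_) (*-inverseˡ r)) (*-identityʳ q))

------------------------------------------------------------------------
-- Straight-line programs

-- Up to renaming, the finite set of nonterminals is Fin nonterminals; the
-- disjoint union keeps it apart from the terminals.  Since prod is a function,
-- every nonterminal has exactly one production.
record SLP (A : Set) : Set where
  field
    nonterminals : ℕ
    start        : Fin nonterminals
    prod         : Fin nonterminals → List⁺ (Fin nonterminals ⊎ A)

  _OccursIn_ : Rel (Fin nonterminals) 0ℓ
  Y OccursIn X = inj₁ Y ∈ toList (prod X)

  field
    acyclic : ∀ X → ¬ TransClosure _OccursIn_ X X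

  size : ℕ
  size = sum (map (λ X → List⁺.length (prod X)) (allFin nonterminals))

  OccursIn-wellFounded : WellFounded _OccursIn_
  OccursIn-wellFounded = wellFounded⁻ _ (spo-wellFounded record
    { isEquivalence = isEquivalence
    ; irrefl        = λ { {X} refl → acyclic X }
    ; trans         = transitive _
    ; <-resp-≈      = resp₂ _
    })

  -- val(X) for X → x₁…xₗ is val(x₁)…val(xₗ), where val(a) = a for a terminal.
  mutual
    valᴬ : ∀ X → Acc _OccursIn_ X → List A
    valᴬ X (acc rs) =
      concat (mapWith∈ (toList (prod X)) (λ {x} x∈ → symᴬ rs x x∈))

    symᴬ : ∀ {X} → (∀ {Y} → Y OccursIn X → Acc _OccursIn_ Y) →
           ∀ x → x ∈ toList (prod X) → List A
    symᴬ rs (inj₁ Y) Y∈ = valᴬ Y (rs Y∈)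
    symᴬ rs (inj₂ a) _  = a ∷ []

  valₙ : Fin nonterminals → List A
  valₙ X = valᴬ X (OccursIn-wellFounded X)

  val : List A
  val = valₙ start

open SLP public using (nonterminals; start; prod; size; val)

-- Letters are natural numbers, so that ℕ contains every alphabet [1,k].
Letter : Set
Letter = ℕ

Word : Set
Word = List⁺ Letter

Produces : SLP Letter → Word → Set
Produces 𝔸 w = val 𝔸 ≡ toList w

-- g(w) = m
IsSmallestSize : Word → ℕ → Set
IsSmallestSize w m =
  (∃[ 𝔸 ] Produces 𝔸 w × size 𝔸 ≡ m) × (∀ 𝔸 → Produces 𝔸 w → m ℕ.≤ size 𝔸)

------------------------------------------------------------------------
-- The machine model: Jones's language WHILE over binary trees, which is
-- polynomially equivalent to Turing machines.  It has no built-in equality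
-- test on trees, so that every step costs constant time on a pointer machine.

infixr 5 _∙_
data Tree : Set where
  nil : Tree
  _∙_ : Tree → Tree → Tree

∣_∣ᵗ : Tree → ℕ
∣ nil ∣ᵗ   = 1
∣ s ∙ t ∣ᵗ = suc (∣ s ∣ᵗ ℕ.+ ∣ t ∣ᵗ)

hdᵗ tlᵗ : Tree → Tree
hdᵗ nil     = nil
hdᵗ (s ∙ t) = s
tlᵗ nil     = nil
tlᵗ (s ∙ t) = t

data Expr (k : ℕ) : Set where
  var   : Fin k → Expr k
  nil   : Expr k
  cons  : Expr k → Expr k → Expr k
  hd tl : Expr k → Expr k

infixr 4 _⨾_
infix  5 _:=_
data Cmd (k : ℕ) : Set where
  skip          : Cmd k
  _:=_          : Fin k → Expr k → Cmd k
  _⨾_           : Cmd k → Cmd k → Cmd k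
  if_then_else_ : Expr k → Cmd k → Cmd k → Cmd k
  while_loop_   : Expr k → Cmd k → Cmd k

Store : ℕ → Set
Store k = Vec Tree k

eval : ∀ {k} → Expr k → Store k → Tree
eval (var x)    σ = lookup σ x
eval nil        σ = nil
eval (cons e f) σ = eval e σ ∙ eval f σ
eval (hd e)     σ = hdᵗ (eval e σ)
eval (tl e)     σ = tlᵗ (eval e σ)

cost : ∀ {k} → Expr k → ℕ
cost (var x)    = 1
cost nil        = 1
cost (cons e f) = suc (cost e ℕ.+ cost f)
cost (hd e)     = suc (cost e)
cost (tl e)     = suc (cost e)

data True : Tree → Set where
  true : ∀ {s t} → True (s ∙ t)

-- ⟨ c , σ ⟩⇓[ t ] τ : started in σ, the command c halts in τ after time t.
data ⟨_,_⟩⇓[_]_ {k : ℕ} : Cmd k → Store k → ℕ → Store k → Set where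
  ⇓skip : ∀ {σ} → ⟨ skip , σ ⟩⇓[ 1 ] σ
  ⇓:= : ∀ {x e σ} → ⟨ x := e , σ ⟩⇓[ suc (cost e) ] (σ [ x ]≔ eval e σ)
  ⇓⨾ : ∀ {c d σ τ υ s t} →
    ⟨ c , σ ⟩⇓[ s ] τ → ⟨ d , τ ⟩⇓[ t ] υ → ⟨ c ⨾ d , σ ⟩⇓[ s ℕ.+ t ] υ
  ⇓then : ∀ {e c d σ τ t} → True (eval e σ) →
    ⟨ c , σ ⟩⇓[ t ] τ → ⟨ if e then c else d , σ ⟩⇓[ suc (cost e) ℕ.+ t ] τ
  ⇓else : ∀ {e c d σ τ t} → eval e σ ≡ nil →
    ⟨ d , σ ⟩⇓[ t ] τ → ⟨ if e then c else d , σ ⟩⇓[ suc (cost e) ℕ.+ t ] τ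
  ⇓loop : ∀ {e c σ τ υ s t} → True (eval e σ) →
    ⟨ c , σ ⟩⇓[ s ] τ → ⟨ while e loop c , τ ⟩⇓[ t ] υ →
    ⟨ while e loop c , σ ⟩⇓[ suc (cost e) ℕ.+ (s ℕ.+ t) ] υ
  ⇓exit : ∀ {e c σ} → eval e σ ≡ nil →
    ⟨ while e loop c , σ ⟩⇓[ suc (cost e) ] σ

-- The first variable holds the input and finally the output; the other
-- `extra` variables are initially nil.
record Program : Set where
  field
    extra : ℕ
    body  : Cmd (suc extra)

_⟦_⟧↦_within_ : Program → Tree → Tree → ℕ → Set
P ⟦ i ⟧↦ o within b =
  ∃[ τ ] ∃[ t ] ⟨ body , i ∷ replicate extra nil ⟩⇓[ t ] τ × head τ ≡ o × t ℕ.≤ b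
  where open Program P

PolyTime : {A B : Set} → (A → Tree) → (B → Tree) → (A → B) → Set
PolyTime encA encB f =
  ∃[ P ] ∃[ a ] ∃[ d ] ∃[ b ] ∀ x →
    P ⟦ encA x ⟧↦ encB (f x) within (a ℕ.* ∣ encA x ∣ᵗ ℕ.^ d ℕ.+ b)

------------------------------------------------------------------------
-- Encodings.  Letters, which may be arbitrarily large, are written in
-- (bijective) binary.  Nonterminals are written in unary; this is harmless as
-- a nonterminal is smaller than the number of productions.

encList : {A : Set} → (A → Tree) → List A → Tree
encList enc []       = nil
encList enc (x ∷ xs) = enc x ∙ encList enc xs

encℕᵇ : ℕᵇ → Tree
encℕᵇ ℕᵇ.zero  = nil
encℕᵇ 2[1+ n ] = nil ∙ encℕᵇ n
encℕᵇ 1+[2 n ] = (nil ∙ nil) ∙ encℕᵇ n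

encLetter : Letter → Tree
encLetter a = encℕᵇ (ℕᵇ.fromℕ a)

encUnary : ℕ → Tree
encUnary ℕ.zero  = nil
encUnary (suc n) = nil ∙ encUnary n

encWord : Word → Tree
encWord w = encList encLetter (toList w)

encSymbol : ∀ {m} → Fin m ⊎ Letter → Tree
encSymbol (inj₁ X) = nil ∙ encUnary (toℕ X)
encSymbol (inj₂ a) = (nil ∙ nil) ∙ encLetter a

encSLP : SLP Letter → Tree
encSLP 𝔸 = encUnary (toℕ (start 𝔸))
  ∙ encList (λ X → encList encSymbol (toList (prod 𝔸 X))) (allFin (nonterminals 𝔸))

------------------------------------------------------------------------
-- Grammar-based compressors

record Compressor : Set where
  field
    compress : Word → SLP Letter
    correct  : ∀ w → Produces (compress w) w

open Compressor public

IsPolynomialTime : Compressor → Set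
IsPolynomialTime 𝒞 = PolyTime encWord encSLP (compress 𝒞)

-- w ∈ [1,k]ⁿ
infix 4 _∈[1,_]^_
_∈[1,_]^_ : Word → ℕ → ℕ → Set
w ∈[1, k ]^ n = All (λ a → 1 ℕ.≤ a × a ℕ.≤ k) (toList w) × List⁺.length w ≡ n

-- r ∈ { |𝒞(w)| / g(w) ∣ w ∈ [1,k]ⁿ }.  The instance hypothesis g ≢ 0 excludes
-- nothing, as right-hand sides of productions are nonempty.
IsRatio : Compressor → ℕ → ℕ → ℚ → Set
IsRatio 𝒞 k n r =
  ∃[ w ] w ∈[1, k ]^ n ×
    (∃[ g ] IsSmallestSize w g ×
      Σ (ℕ.NonZero g) λ g≢0 → r ≡ ℚ._/_ (+ size (compress 𝒞 w)) g {{g≢0}})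

-- α_𝒞(k,n) ≤ x, where α_𝒞(k,n) is the maximum of the above finite set.
infix 4 α[_][_,_]≤_
α[_][_,_]≤_ : Compressor → ℕ → ℕ → ℝ → Set
α[ 𝒞 ][ k , n ]≤ x = ∀ r → IsRatio 𝒞 k n r → r ≤ʳ x

{-# OPTIONS --safe #-}

-- Let a₀, …, aₖ₋₁ be the letters of w, and let φ replace aᵢ by 1ⁱ2.  An SLP for w
-- becomes one for φ(w) by adding the rules A₀ → 2 and Aᵢ → 1Aᵢ₋₁, of total size less
-- than 2k ≤ 2g(w); so g(φ(w)) ≤ 3g(w).  Conversely, let an SLP produce φ(w).  If X
-- produces 1ᵖ 2 φ(u) 1ᑫ, let X produce u instead: in a rule X → x₁…xₗ, each gap
-- between two consecutive xᵢ containing a 2 contributes one letter, so the new rule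
-- has length at most 2l - 1.  The start nonterminal also needs the first letter of
-- w, hence the size at most doubles.  Encoding, compressing and decoding thus loses
-- a factor of 3 · 2.

module Submission where

open import Defs
open import Algebra.Properties.CommutativeSemigroup using (interchange)
open import Data.Bool.Base as Bool using (Bool; true; false; T; not; _∧_)
open import Data.Empty using (⊥; ⊥-elim)
open import Data.Fin.Base as Fin using (Fin; zero; suc; toℕ; _↑ˡ_; _↑ʳ_; splitAt; inject₁; fromℕ<; punchIn)
import Data.Fin.Properties as Fin
import Data.Integer.Base as ℤ
import Data.Integer.Properties as ℤ
open import Data.List.Base as List using (List; []; _∷_; _++_; [_]; length; map; concat; foldl; foldr; reverse; drop; null; concatMap; allFin; tabulate)
import Data.List.Properties as List
open import Data.List.Membership.Propositional using (_∈_; find)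
open import Data.List.Membership.Propositional.Properties using (mapWith∈-cong; mapWith∈≗map; ∈-++⁻; ∈-map⁻; ∈-allFin; ∈-lookup; ∈-concatMap⁺; ∈-concatMap⁻)
open import Data.List.NonEmpty.Base as List⁺ using (List⁺; toList; _∷_)
open import Data.List.Relation.Unary.All as All using (All; []; _∷_)
import Data.List.Relation.Unary.All.Properties as All
open import Data.List.Relation.Unary.AllPairs using ([]; _∷_)
open import Data.List.Relation.Unary.Any as Any using (here; there)
open import Data.List.Relation.Unary.Any.Properties using (lookup-index; reverse⁻)
open import Data.List.Relation.Unary.Unique.Propositional using (Unique)
import Data.List.Relation.Unary.Unique.Propositional.Properties as Unique
open import Data.Nat.Base hiding (_/_)
open import Data.Nat.Binary.Base as ℕᵇ using (ℕᵇ; 2[1+_]; 1+[2_])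
open import Data.Nat.Binary.Properties using (fromℕ-injective)
open import Data.Nat.Induction using (<-rec)
open import Data.Nat.ListAction using (sum)
open import Data.Nat.Properties
open import Data.Nat.Solver using (module +-*-Solver)
open import Data.Product.Base using (∃-syntax; _×_; _,_; proj₁; proj₂)
open import Data.Rational.Base as ℚ using (ℚ; 1ℚ; _/_; 1/_; toℚᵘ)
import Data.Rational.Properties as ℚ
open import Data.Rational.Unnormalised.Base as ℚᵘ using (mkℚᵘ)
import Data.Rational.Unnormalised.Properties as ℚᵘ
open import Data.Sum.Base as Sum using (_⊎_; inj₁; inj₂; [_,_]′)
open import Data.Sum.Properties using (inj₂-injective)
open import Data.Unit.Base using (⊤; tt)
open import Data.Vec.Base as Vec using (Vec; []; _∷_; lookup; replicate; insertAt; _[_]≔_)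
open import Data.Vec.Properties using (insertAt-punchIn)
open import Function.Base using (_∘_; id)
open import Induction.WellFounded using (Acc; acc; WellFounded; wf⇒asym)
open import Level using (0ℓ)
open import Relation.Binary.Construct.Closure.Transitive as Plus using (TransClosure; _∷_; wellFounded)
open import Relation.Binary.Core using (Rel)
open import Relation.Binary.Definitions using (tri<; tri≈; tri>)
open import Relation.Binary.PropositionalEquality hiding ([_])
open import Relation.Nullary using (¬_; yes; no; contradiction)

-- The blocks 1ⁱ2 share their suffixes, so each one costs a single rule of length at most 2 however
-- long it is, and k ≤ g(w) since every letter of w occupies a place in some right-hand side.
-- Decoding is local: a block cut by the boundary of two symbols is recovered from two numbers, the
-- ones ending the left word and the ones beginning the right word. The difficulty lies in making
-- this polynomial on the concrete machine. The compressed program arrives as a bare tree, its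
-- nonterminals come in any order, and unreachable ones may produce enormous blocks or foreign
-- letters. Decoding is therefore defined twice: on typed SLPs, where acyclicity and `val` make
-- sense, and on lists of rules over plain numbers, which the machine can process. The two versions
-- are shown to agree. Running times come from combinators that pair a command with a polynomial, so
-- the whole compressor is assembled like a functional program.

private variable
  V W : Set

headOr : V → List V → V
headOr x []      = x
headOr x (y ∷ _) = y

-- Straight-line programs

wellFounded⇒acyclic : {_<_ : Rel V 0ℓ} → WellFounded _<_ → ∀ x → ¬ TransClosure _<_ x x
wellFounded⇒acyclic wf x x<x = wf⇒asym (wellFounded _ wf) x<x x<x

module _ (𝔸 : SLP V) where
  open SLP 𝔸 using (_OccursIn_; valᴬ; symᴬ; valₙ; OccursIn-wellFounded)

  symVal : Fin (nonterminals 𝔸) ⊎ V → List V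
  symVal (inj₁ X) = valₙ X
  symVal (inj₂ a) = a ∷ []

  -- The accessibility proof that reaches Y through X need not be the one that
  -- `OccursIn-wellFounded` gives for Y itself, so `valₙ` can be unfolded only once the choice is
  -- known not to matter.
  valᴬ-irrelevant : ∀ X (p q : Acc _OccursIn_ X) → valᴬ X p ≡ valᴬ X q
  symᴬ-irrelevant : ∀ {X} (p q : ∀ {Y} → Y OccursIn X → Acc _OccursIn_ Y) x x∈ → symᴬ p x x∈ ≡ symᴬ q x x∈
  valᴬ-irrelevant X (acc p) (acc q) = cong concat
    (mapWith∈-cong (toList (prod 𝔸 X)) _ _ (symᴬ-irrelevant p q _))
  symᴬ-irrelevant p q (inj₁ Y) Y∈ = valᴬ-irrelevant Y (p Y∈) (q Y∈)
  symᴬ-irrelevant p q (inj₂ a) _  = refl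

  -- The equation free of accessibility proofs through which all later arguments about values go.
  valₙ-unfold : ∀ X → valₙ X ≡ concatMap symVal (toList (prod 𝔸 X))
  valₙ-unfold X with OccursIn-wellFounded X
  ... | acc p = cong concat (trans
    (mapWith∈-cong (toList (prod 𝔸 X)) _ _ (λ {x} → symVal≡ x))
    (mapWith∈≗map symVal (toList (prod 𝔸 X))))
    where
    symVal≡ : ∀ x x∈ → symᴬ p x x∈ ≡ symVal x
    symVal≡ (inj₁ Y) Y∈ = valᴬ-irrelevant Y (p Y∈) (OccursIn-wellFounded Y)
    symVal≡ (inj₂ a) _  = refl

concatMap-cong-∈ : {f g : V → List W} → ∀ xs → (∀ {x} → x ∈ xs → f x ≡ g x) → concatMap f xs ≡ concatMap g xs
concatMap-cong-∈ []       f≡g = refl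
concatMap-cong-∈ (x ∷ xs) f≡g = cong₂ _++_ (f≡g (here refl)) (concatMap-cong-∈ xs (f≡g ∘ there))

-- A dictionary of the letters of a word

-- 0 for n ≥ length D.
at : List Letter → ℕ → Letter
at D n = headOr 0 (drop n D)

-- Here and in `dedup` and `index`, the fold and the boolean test have exactly the shape that
-- `foldr-additive` and `If_Then_Else_` produce, so the machine programs compute these functions by
-- definition.
elem : List Letter → Letter → Bool
elem D a = foldr (λ x b → Bool.if x ≡ᵇ a then true else b) false D

dedup : List Letter → List Letter
dedup = foldr (λ x D → Bool.if elem D x then D else x ∷ D) []

-- length D for a ∉ D.
index : List Letter → Letter → ℕ
index D a = foldr (λ x n → Bool.if x ≡ᵇ a then 0 else suc n) 0 D

≡ᵇ-true : ∀ {m n} → (m ≡ᵇ n) ≡ true → m ≡ n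
≡ᵇ-true {m} {n} eq = ≡ᵇ⇒≡ m n (subst T (sym eq) tt)

≡ᵇ-false : ∀ {m n} → (m ≡ᵇ n) ≡ false → m ≢ n
≡ᵇ-false {m} {n} eq m≡n = subst T eq (≡⇒≡ᵇ m n m≡n)

≡ᵇ-refl : ∀ n → (n ≡ᵇ n) ≡ true
≡ᵇ-refl zero    = refl
≡ᵇ-refl (suc n) = ≡ᵇ-refl n

elem-true : ∀ D a → elem D a ≡ true → a ∈ D
elem-true (x ∷ D) a eq with x ≡ᵇ a in x≡a
... | true  = here (sym (≡ᵇ-true x≡a))
... | false = there (elem-true D a eq)

elem-false : ∀ D a → elem D a ≡ false → All (a ≢_) D
elem-false []      a eq = []
elem-false (x ∷ D) a eq with x ≡ᵇ a in x≡a
... | false = (≡ᵇ-false x≡a ∘ sym) ∷ elem-false D a eq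

∈-dedup⁺ : ∀ {a} w → a ∈ w → a ∈ dedup w
∈-dedup⁺ (x ∷ w) a∈ with elem (dedup w) x in eq
∈-dedup⁺ (x ∷ w) (here refl) | true  = elem-true (dedup w) x eq
∈-dedup⁺ (x ∷ w) (there a∈)  | true  = ∈-dedup⁺ w a∈
∈-dedup⁺ (x ∷ w) (here refl) | false = here refl
∈-dedup⁺ (x ∷ w) (there a∈)  | false = there (∈-dedup⁺ w a∈)

∈-dedup⁻ : ∀ {a} w → a ∈ dedup w → a ∈ w
∈-dedup⁻ (x ∷ w) a∈ with elem (dedup w) x
∈-dedup⁻ (x ∷ w) a∈          | true  = there (∈-dedup⁻ w a∈)
∈-dedup⁻ (x ∷ w) (here refl) | false = here refl
∈-dedup⁻ (x ∷ w) (there a∈)  | false = there (∈-dedup⁻ w a∈)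

dedup-unique : ∀ w → Unique (dedup w)
dedup-unique []      = []
dedup-unique (x ∷ w) with elem (dedup w) x in eq
... | true  = dedup-unique w
... | false = elem-false (dedup w) x eq ∷ dedup-unique w

at-index : ∀ {a} D → a ∈ D → at D (index D a) ≡ a
at-index {a} (x ∷ D) a∈ with x ≡ᵇ a in x≡a
at-index (x ∷ D) a∈          | true  = ≡ᵇ-true x≡a
at-index (x ∷ D) (here refl) | false = contradiction refl (≡ᵇ-false {x} x≡a)
at-index (x ∷ D) (there a∈)  | false = at-index D a∈

index< : ∀ {a} D → a ∈ D → index D a < length D
index< {a} (x ∷ D) a∈ with x ≡ᵇ a in x≡a
index< (x ∷ D) a∈          | true  = s≤s z≤n
index< (x ∷ D) (here refl) | false = contradiction refl (≡ᵇ-false {x} x≡a)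
index< (x ∷ D) (there a∈)  | false = s≤s (index< D a∈)

at-⊓ : ∀ D n → at D (length D ⊓ n) ≡ at D n
at-⊓ []      n       = sym (cong (headOr 0) (List.drop-[] n))
at-⊓ (x ∷ D) zero    = refl
at-⊓ (x ∷ D) (suc n) = at-⊓ D n

-- Truncation is a congruence for addition: once a summand reaches k, both sides are k, and
-- otherwise the inner truncations do nothing.
⊓-absorbs-+ : ∀ k m n → k ⊓ (k ⊓ m + k ⊓ n) ≡ k ⊓ (m + n)
⊓-absorbs-+ k m n with ≤-total k m | ≤-total k n
... | inj₁ k≤m | _ rewrite m≤n⇒m⊓n≡m k≤m = trans (m≤n⇒m⊓n≡m (m≤m+n k _)) (sym (m≤n⇒m⊓n≡m (m≤n⇒m≤n+o n k≤m)))
... | inj₂ m≤k | inj₁ k≤n rewrite m≤n⇒m⊓n≡m k≤n = trans (m≤n⇒m⊓n≡m (m≤n+m k _)) (sym (m≤n⇒m⊓n≡m (m≤n⇒m≤o+n m k≤n)))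
... | inj₂ m≤k | inj₂ n≤k rewrite m≥n⇒m⊓n≡n m≤k | m≥n⇒m⊓n≡n n≤k = refl

encodeLetter : List Letter → Letter → List Letter
encodeLetter D a = List.replicate (index D a) 1 ++ [ 2 ]

-- Summaries of words over {1, 2}

-- (false , p , _ , _) stands for the block 1ᵖ, and (true , p , q , u) for a word
-- 1ᵖ 2 v 1ᑫ where v is the encoding of u.
Summary : Set → Set
Summary V = Bool × ℕ × ℕ × List V

unit : Summary V
unit = false , 0 , 0 , []

middle : Summary V → List V
middle (_ , _ , _ , u) = u

-- Multiplication corresponds to concatenation.  The block between the last 2 of
-- the left word and the first 2 of the right word becomes complete and encodes a
-- letter, which ι turns into a symbol.
module _ (ι : Letter → V) (D : List Letter) where

  mul : Summary V → Summary V → Summary V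
  mul (true  , p , q , u) (true  , p′ , q′ , u′) = true , p , q′ , u ++ ι (at D (q + p′)) ∷ u′
  mul (true  , p , q , u) (false , p′ , q′ , u′) = true , p , q + p′ , u
  mul (false , p , q , u) (b     , p′ , q′ , u′) = b , p + p′ , q′ , u′

  -- When ones are regrouped, both sides measure the same block cut at two places. Associativity
  -- lets `summarize`, a fold over single letters, be split at arbitrary boundaries.
  mul-assoc : ∀ l m r → mul (mul l m) r ≡ mul l (mul m r)
  mul-assoc (true , p , q , u) (true , p′ , q′ , u′) (true , p″ , q″ , u″) =
    cong (λ v → true , p , q″ , v) (List.++-assoc u _ _)
  mul-assoc (true , p , q , u) (true , p′ , q′ , u′) (false , p″ , q″ , u″) = refl
  mul-assoc (true , p , q , u) (false , p′ , q′ , u′) (true , p″ , q″ , u″) =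
    cong (λ n → true , p , q″ , u ++ ι (at D n) ∷ u″) (+-assoc q p′ p″)
  mul-assoc (true , p , q , u) (false , p′ , q′ , u′) (false , p″ , q″ , u″) =
    cong (λ n → true , p , n , u) (+-assoc q p′ p″)
  mul-assoc (false , p , q , u) (true , p′ , q′ , u′) (true , p″ , q″ , u″) = refl
  mul-assoc (false , p , q , u) (true , p′ , q′ , u′) (false , p″ , q″ , u″) = refl
  mul-assoc (false , p , q , u) (false , p′ , q′ , u′) (b , p″ , q″ , u″) =
    cong (λ n → b , n , q″ , u″) (+-assoc p p′ p″)

-- Nonterminals which do not contribute to val may produce exponentially long
-- blocks.  Truncating them at length D is harmless, as at D is constant from there.
clamp : ℕ → Summary V → Summary V
clamp k (b , p , q , u) = b , k ⊓ p , k ⊓ q , u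

⊓-idem₂ : ∀ k p → k ⊓ (k ⊓ p) ≡ k ⊓ p
⊓-idem₂ k p = trans (sym (⊓-assoc k k p)) (cong (_⊓ p) (⊓-idem k))

-- The new letter survives because `at D` cannot distinguish numbers from `length D` on, and the
-- outer blocks because truncated addition absorbs truncation. Hence truncating at every step of a
-- fold amounts to truncating once at the end.
clamp-mul : ∀ (ι : Letter → V) D m n → let k = length D in
            clamp k (mul ι D (clamp k m) (clamp k n)) ≡ clamp k (mul ι D m n)
clamp-mul ι D (true , p , q , u) (true , p′ , q′ , u′)
  rewrite ⊓-idem₂ (length D) p | ⊓-idem₂ (length D) q′ =
  cong (λ a → true , _ , _ , u ++ ι a ∷ u′) (begin
    at D (length D ⊓ q + length D ⊓ p′)              ≡⟨ at-⊓ D _ ⟨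
    at D (length D ⊓ (length D ⊓ q + length D ⊓ p′)) ≡⟨ cong (at D) (⊓-absorbs-+ (length D) q p′) ⟩
    at D (length D ⊓ (q + p′))                       ≡⟨ at-⊓ D _ ⟩
    at D (q + p′)                                    ∎)
  where open ≡-Reasoning
clamp-mul ι D (true , p , q , u) (false , p′ , q′ , u′)
  rewrite ⊓-idem₂ (length D) p | ⊓-absorbs-+ (length D) q p′ = refl
clamp-mul ι D (false , p , q , u) (b , p′ , q′ , u′)
  rewrite ⊓-absorbs-+ (length D) p p′ | ⊓-idem₂ (length D) q′ = refl

expand : (V → List W) → Summary V → Summary W
expand ε (b , p , q , u) = b , p , q , concatMap ε u

-- Substituting words for symbols leaves the outer blocks alone; the hypothesis on `ι` and `κ`
-- identifies the letter that a gap creates on either side.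
expand-mul : ∀ (ε : V → List W) ι κ D → (∀ a → ε (ι a) ≡ [ κ a ]) → ∀ m n →
             expand ε (mul ι D m n) ≡ mul κ D (expand ε m) (expand ε n)
expand-mul ε ι κ D ει (true , p , q , u) (true , p′ , q′ , u′) =
  cong (λ v → true , p , q′ , v) (trans (List.concatMap-++ ε u _)
    (cong (λ v → concatMap ε u ++ v ++ concatMap ε u′) (ει _)))
expand-mul ε ι κ D ει (true , p , q , u) (false , p′ , q′ , u′) = refl
expand-mul ε ι κ D ει (false , p , q , u) (b , p′ , q′ , u′) = refl

-- Such nonterminals may also contain letters other than 1 and 2, read as 2.
letterSummary : Letter → Summary V
letterSummary a = Bool.if a ≡ᵇ 1 then (false , 1 , 0 , []) else (true , 0 , 0 , [])

summarize : List Letter → List Letter → Summary Letter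
summarize D = foldr (λ a → mul id D (letterSummary a)) unit

summarize-++ : ∀ D v w → summarize D (v ++ w) ≡ mul id D (summarize D v) (summarize D w)
summarize-++ D []      w = refl
summarize-++ D (a ∷ v) w = trans (cong (mul id D (letterSummary a)) (summarize-++ D v w))
  (sym (mul-assoc id D (letterSummary a) (summarize D v) (summarize D w)))

summarize-block : ∀ D n → summarize D (List.replicate n 1 ++ [ 2 ]) ≡ (true , n , 0 , [])
summarize-block D zero    = refl
summarize-block D (suc n) = cong (mul id D (letterSummary 1)) (summarize-block D n)

-- The first block has no 2 on its left, so `a` remains visible only as the number of leading ones.
-- Every later block is closed on both sides, and `at-index` turns its length back into a letter.
summarize-encoding : ∀ D a w → (∀ {b} → b ∈ w → b ∈ D) →
  summarize D (concatMap (encodeLetter D) (a ∷ w)) ≡ (true , index D a , 0 , w)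
summarize-encoding D a [] w⊆D =
  trans (summarize-++ D (encodeLetter D a) []) (cong (λ m → mul id D m unit) (summarize-block D (index D a)))
summarize-encoding D a (b ∷ w) w⊆D = begin
  summarize D (encodeLetter D a ++ concatMap (encodeLetter D) (b ∷ w))
    ≡⟨ summarize-++ D (encodeLetter D a) _ ⟩
  mul id D (summarize D (encodeLetter D a)) (summarize D (concatMap (encodeLetter D) (b ∷ w)))
    ≡⟨ cong₂ (mul id D) (summarize-block D (index D a)) (summarize-encoding D b w (w⊆D ∘ there)) ⟩
  (true , index D a , 0 , at D (index D b) ∷ w)
    ≡⟨ cong (λ c → true , index D a , 0 , c ∷ w) (at-index D (w⊆D (here refl))) ⟩
  (true , index D a , 0 , b ∷ w) ∎
  where open ≡-Reasoning

-- Summaries of nonterminals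

module _ {Y : Set} where

  -- Within another rule X stands for its own middle, and only its outer blocks still interact with
  -- the neighbours. An empty middle is dropped rather than named, because no rule can produce the
  -- empty word.
  collapse : Y → Summary (Y ⊎ Letter) → Summary (Y ⊎ Letter)
  collapse X (b , p , q , u) = b , p , q , (Bool.if null u then [] else [ inj₁ X ])

  symSummary : (Y → Summary (Y ⊎ Letter)) → Y ⊎ Letter → Summary (Y ⊎ Letter)
  symSummary τ (inj₁ X) = collapse X (τ X)
  symSummary τ (inj₂ a) = letterSummary a

  ∈-symSummary : ∀ τ x {X} → inj₁ X ∈ middle (symSummary τ x) → inj₁ X ≡ x
  ∈-symSummary τ (inj₁ X) X∈ with null (middle (τ X))
  ∈-symSummary τ (inj₁ X) (here eq) | false = eq
  ∈-symSummary τ (inj₂ a) X∈ with a ≡ᵇ 1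
  ∈-symSummary τ (inj₂ a) () | true
  ∈-symSummary τ (inj₂ a) () | false

  length-symSummary : ∀ τ x → length (middle (symSummary τ x)) ≤ 1
  length-symSummary τ (inj₁ X) with null (middle (τ X))
  ... | true  = z≤n
  ... | false = ≤-refl
  length-symSummary τ (inj₂ a) with a ≡ᵇ 1
  ... | true  = z≤n
  ... | false = z≤n

module _ {Y : Set} (D : List Letter) where

  step : (Y → Summary (Y ⊎ Letter)) → Y ⊎ Letter → Summary (Y ⊎ Letter) → Summary (Y ⊎ Letter)
  step τ x m = clamp (length D) (mul inj₂ D (symSummary τ x) m)

  rhsSummary : (Y → Summary (Y ⊎ Letter)) → List (Y ⊎ Letter) → Summary (Y ⊎ Letter)
  rhsSummary τ = foldr (step τ) unit

  rhsSummary-cong : ∀ {τ υ} xs → (∀ {X} → inj₁ X ∈ xs → τ X ≡ υ X) → rhsSummary τ xs ≡ rhsSummary υ xs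
  rhsSummary-cong []            eq = refl
  rhsSummary-cong (inj₁ X ∷ xs) eq =
    cong₂ (λ s m → clamp (length D) (mul inj₂ D (collapse X s) m)) (eq (here refl)) (rhsSummary-cong xs (eq ∘ there))
  rhsSummary-cong {τ} (inj₂ a ∷ xs) eq = cong (step τ (inj₂ a)) (rhsSummary-cong xs (eq ∘ there))

  ∈-mul : ∀ m n {X : Y} → inj₁ X ∈ middle (mul inj₂ D m n) → inj₁ X ∈ middle m ⊎ inj₁ X ∈ middle n
  ∈-mul (true , p , q , u) (true , p′ , q′ , u′) X∈ with ∈-++⁻ u X∈
  ... | inj₁ X∈u          = inj₁ X∈u
  ... | inj₂ (there X∈u′) = inj₂ X∈u′
  ∈-mul (true , p , q , u) (false , p′ , q′ , u′) X∈ = inj₁ X∈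
  ∈-mul (false , p , q , u) (b , p′ , q′ , u′) X∈ = inj₂ X∈

  ∈-rhsSummary : ∀ τ xs {X} → inj₁ X ∈ middle (rhsSummary τ xs) → inj₁ X ∈ xs
  ∈-rhsSummary τ (x ∷ xs) X∈ with ∈-mul (symSummary τ x) (rhsSummary τ xs) X∈
  ... | inj₁ X∈x  = here (∈-symSummary τ x X∈x)
  ... | inj₂ X∈xs = there (∈-rhsSummary τ xs X∈xs)

  -- l symbols, r of which contain a 2, contribute at most r nonterminals and
  -- r - 1 letters between them.
  Short : ℕ → Summary (Y ⊎ Letter) → Set
  Short l (false , _ , _ , u) = length u ≡ 0
  Short l (true  , _ , _ , u) = suc (length u) ≤ l + l

  short-mul : ∀ l m n → length (middle m) ≤ 1 → Short l n → Short (suc l) (mul inj₂ D m n)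
  short-mul l (true , p , q , u) (true , p′ , q′ , u′) u≤1 s = s≤s (begin
    length (u ++ _ ∷ u′)         ≡⟨ List.length-++ u ⟩
    length u + suc (length u′)   ≤⟨ +-mono-≤ u≤1 s ⟩
    suc (l + l)                  ≡⟨ +-suc l l ⟨
    l + suc l                    ∎)
    where open ≤-Reasoning
  short-mul l (true , p , q , u) (false , p′ , q′ , u′) u≤1 s = s≤s (≤-trans u≤1 (≤-trans (s≤s z≤n) (m≤n+m (suc l) l)))
  short-mul l (false , p , q , u) (true , p′ , q′ , u′) u≤1 s = m≤n⇒m≤1+n (≤-trans s (+-monoʳ-≤ l (n≤1+n l)))
  short-mul l (false , p , q , u) (false , p′ , q′ , u′) u≤1 s = s

  short-rhsSummary : ∀ τ xs → Short (length xs) (rhsSummary τ xs)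
  short-rhsSummary τ []       = refl
  short-rhsSummary τ (x ∷ xs) = short-clamp (mul inj₂ D (symSummary τ x) (rhsSummary τ xs))
    (short-mul (length xs) (symSummary τ x) (rhsSummary τ xs) (length-symSummary τ x) (short-rhsSummary τ xs))
    where
    short-clamp : ∀ {l k} m → Short l m → Short l (clamp k m)
    short-clamp (true  , _) s = s
    short-clamp (false , _) s = s

  -- The spare unit pays for the first letter in the rule of the start nonterminal, or for the junk
  -- letter of an empty rule. If no 2 occurs, it is available because the old right-hand side is
  -- nonempty.
  length-rhsSummary : ∀ τ x xs → suc (length (middle (rhsSummary τ (x ∷ xs)))) ≤ length (x ∷ xs) + length (x ∷ xs)
  length-rhsSummary τ x xs = short⇒length (rhsSummary τ (x ∷ xs)) (short-rhsSummary τ (x ∷ xs))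
    where
    short⇒length : ∀ {l} m → Short (suc l) m → suc (length (middle m)) ≤ suc l + suc l
    short⇒length (false , _) s = ≤-trans (≤-reflexive (cong suc s)) (s≤s z≤n)
    short⇒length (true  , _) s = s

-- The decoded program

module Decode (𝔸 : SLP Letter) (D : List Letter) where
  open SLP 𝔸 using (_OccursIn_; valₙ; acyclic; OccursIn-wellFounded)

  N : ℕ
  N = nonterminals 𝔸

  rhs : Fin N → List (Fin N ⊎ Letter)
  rhs X = toList (prod 𝔸 X)

  -- Nonterminals need not be listed in topological order, so their summaries are
  -- computed by iteration.  A summary still changing in round t is the top of a
  -- descending chain of t + 1 nonterminals, hence N rounds suffice.
  table : ℕ → Fin N → Summary (Fin N ⊎ Letter)
  table zero    X = unit
  table (suc t) X = rhsSummary D (table t) (rhs X)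

  data Chain (X : Fin N) : ℕ → Set where
    []  : Chain X 0
    _∷_ : ∀ {Y t} → Y OccursIn X → Chain Y t → Chain X (suc t)

  node : ∀ {X t} → Chain X t → Fin (suc t) → Fin N
  node {X} c        zero    = X
  node     (_ ∷ c)  (suc i) = node c i

  descending : ∀ {X t} (c : Chain X t) i j → i Fin.< j → TransClosure _OccursIn_ (node c j) (node c i)
  descending (Y∈ ∷ c) zero (suc zero)    _         = Plus.[ Y∈ ]
  descending (Y∈ ∷ c) zero (suc (suc j)) _         = descending c zero (suc j) (s≤s z≤n) Plus.∷ʳ Y∈
  descending (Y∈ ∷ c) (suc i) (suc j)    (s≤s i<j) = descending c i j i<j

  -- Such a chain has N + 1 nodes among N nonterminals; two of them coincide by the pigeonhole
  -- principle, which closes a cycle.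
  no-long-chain : ∀ {X} → ¬ Chain X N
  no-long-chain c =
    let (i , j , i<j , eq) = Fin.pigeonhole (n<1+n N) (node c)
    in acyclic (node c i) (subst (λ Z → TransClosure _OccursIn_ Z (node c i)) (sym eq) (descending c i j i<j))

  -- If all nonterminals on the right-hand side of X are stable in one round, X is stable in the
  -- next; an unstable one extends the chain. The alternatives need not exclude each other, so
  -- summaries are never compared.
  stable-or-chain : ∀ t X → table t X ≡ table (suc t) X ⊎ Chain X t
  stable-or-chain zero    X = inj₂ []
  stable-or-chain (suc t) X = Sum.map (λ eq → rhsSummary-cong D (rhs X) (eq _)) id (scan (rhs X) id)
    where
    scan : ∀ xs → (∀ {x} → x ∈ xs → x ∈ rhs X) →
           (∀ Y → inj₁ Y ∈ xs → table t Y ≡ table (suc t) Y) ⊎ Chain X (suc t)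
    scan []            xs⊆ = inj₁ λ _ ()
    scan (inj₂ a ∷ xs) xs⊆ = Sum.map₁ (λ { eq Y (there Y∈) → eq Y Y∈ }) (scan xs (xs⊆ ∘ there))
    scan (inj₁ Z ∷ xs) xs⊆ with stable-or-chain t Z | scan xs (xs⊆ ∘ there)
    ... | inj₂ c  | _       = inj₂ (xs⊆ (here refl) ∷ c)
    ... | inj₁ _  | inj₂ c  = inj₂ c
    ... | inj₁ eq | inj₁ eqs = inj₁ λ { Y (here refl) → eq ; Y (there Y∈) → eqs Y Y∈ }

  τ : Fin N → Summary (Fin N ⊎ Letter)
  τ = table N

  τ-fixed : ∀ X → τ X ≡ rhsSummary D τ (rhs X)
  τ-fixed X = [ id , (λ c → ⊥-elim (no-long-chain c)) ]′ (stable-or-chain N X)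

  -- A right-hand side must not be empty, even if the nonterminal is never used.
  orJunk : List (Fin N ⊎ Letter) → List⁺ (Fin N ⊎ Letter)
  orJunk []      = inj₂ 0 ∷ []
  orJunk (x ∷ u) = x ∷ u

  -- The middle of val(X) omits the first letter.  For the start nonterminal S this
  -- letter is added to the right-hand side itself (a new start nonterminal could
  -- exceed the size bound 2|𝔸|), so that only the nonterminals below S, which do
  -- not contain S, produce their middle.
  rhs′ : Fin N → List⁺ (Fin N ⊎ Letter)
  rhs′ X = let (_ , p , _ , u) = τ X in
    Bool.if toℕ X ≡ᵇ toℕ (start 𝔸) then inj₂ (at D p) ∷ u else orJunk u

  ∈-rhs′ : ∀ {X Y} → inj₁ Y ∈ toList (rhs′ X) → Y OccursIn X
  ∈-rhs′ {X} {Y} Y∈ = ∈-rhsSummary D τ (rhs X) (subst (λ m → inj₁ Y ∈ middle m) (τ-fixed X) (Y∈τ (toℕ X ≡ᵇ toℕ (start 𝔸)) Y∈))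
    where
    ∈-orJunk : ∀ u → inj₁ Y ∈ toList (orJunk u) → inj₁ Y ∈ u
    ∈-orJunk []      (here ())
    ∈-orJunk []      (there ())
    ∈-orJunk (x ∷ u) Y∈ = Y∈

    Y∈τ : ∀ b {a} → inj₁ Y ∈ toList (Bool.if b then inj₂ a ∷ middle (τ X) else orJunk (middle (τ X))) → inj₁ Y ∈ middle (τ X)
    Y∈τ true  (there Y∈) = Y∈
    Y∈τ false Y∈         = ∈-orJunk (middle (τ X)) Y∈

  𝔻 : SLP Letter
  𝔻 = record
    { nonterminals = N
    ; start        = start 𝔸
    ; prod         = rhs′
    ; acyclic      = λ X → acyclic X ∘ map⁺
    }
    where
    map⁺ : ∀ {X Y} → TransClosure (λ Y X → inj₁ Y ∈ toList (rhs′ X)) X Y → TransClosure _OccursIn_ X Y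
    map⁺ Plus.[ Y∈ ] = Plus.[ ∈-rhs′ Y∈ ]
    map⁺ (Y∈ ∷ p)    = ∈-rhs′ Y∈ ∷ map⁺ p

  ε : Fin N ⊎ Letter → List Letter
  ε = symVal 𝔻

  k : ℕ
  k = length D

  clamp-idem : ∀ (m : Summary V) → clamp k (clamp k m) ≡ clamp k m
  clamp-idem (b , p , q , u) = cong₂ (λ p q → b , p , q , u) (⊓-idem₂ k p) (⊓-idem₂ k q)

  expand-letterSummary : ∀ a → expand ε (letterSummary a) ≡ summarize D [ a ]
  expand-letterSummary a with a ≡ᵇ 1
  ... | true  = refl
  ... | false = refl

  Correct : Fin N → Set
  Correct X = expand ε (τ X) ≡ clamp k (summarize D (valₙ X))

  notStart : ∀ {Y} → TransClosure _OccursIn_ Y (start 𝔸) → (toℕ Y ≡ᵇ toℕ (start 𝔸)) ≡ false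
  notStart {Y} Y<S with toℕ Y ≡ᵇ toℕ (start 𝔸) in eq
  ... | false = refl
  ... | true  = ⊥-elim (acyclic Y (subst (TransClosure _OccursIn_ Y) (sym (Fin.toℕ-injective (≡ᵇ-true eq))) Y<S))

  -- By acyclicity Y is not the start nonterminal, so its new rule is its middle without the
  -- additional first letter. An empty middle expands to the empty word on both sides.
  expand-nonterminal : ∀ Y → TransClosure _OccursIn_ Y (start 𝔸) → expand ε (symSummary τ (inj₁ Y)) ≡ expand ε (τ Y)
  expand-nonterminal Y Y<S with τ Y in eq
  ... | b , p , q , []     = refl
  ... | b , p , q , x ∷ u = cong (λ v → b , p , q , v) (begin
    SLP.valₙ 𝔻 Y ++ []                  ≡⟨ List.++-identityʳ _ ⟩
    SLP.valₙ 𝔻 Y                        ≡⟨ valₙ-unfold 𝔻 Y ⟩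
    concatMap ε (toList (rhs′ Y))       ≡⟨ cong (concatMap ε ∘ toList) rhs≡ ⟩
    concatMap ε (x ∷ u)                 ∎)
    where
    open ≡-Reasoning
    rhs≡ : rhs′ Y ≡ x ∷ u
    rhs≡ rewrite notStart Y<S | eq = refl

  expand-symSummary : ∀ x → (∀ {Y} → inj₁ Y ≡ x → TransClosure _OccursIn_ Y (start 𝔸) × Correct Y) →
    clamp k (expand ε (symSummary τ x)) ≡ clamp k (summarize D (symVal 𝔸 x))
  expand-symSummary (inj₁ Y) c = let (Y<S , eq) = c refl in
    trans (cong (clamp k) (trans (expand-nonterminal Y Y<S) eq)) (clamp-idem _)
  expand-symSummary (inj₂ a) c = cong (clamp k) (expand-letterSummary a)

  expand-rhsSummary : ∀ xs → (∀ {Y} → inj₁ Y ∈ xs → TransClosure _OccursIn_ Y (start 𝔸) × Correct Y) →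
    expand ε (rhsSummary D τ xs) ≡ clamp k (summarize D (concatMap (symVal 𝔸) xs))
  expand-rhsSummary []       c = cong₂ (λ p q → false , p , q , []) (sym (⊓-zeroʳ k)) (sym (⊓-zeroʳ k))
  expand-rhsSummary (x ∷ xs) c = begin
    clamp k (expand ε (mul inj₂ D s m))
      ≡⟨ cong (clamp k) (expand-mul ε inj₂ id D (λ _ → refl) s m) ⟩
    clamp k (mul id D (expand ε s) (expand ε m))
      -- The factors are known only up to truncation: `clamp-mul` inserts truncations so that the
      -- induction hypothesis applies, and a second use removes them.
      ≡⟨ clamp-mul id D (expand ε s) (expand ε m) ⟨
    clamp k (mul id D (clamp k (expand ε s)) (clamp k (expand ε m)))
      ≡⟨ cong₂ (λ s m → clamp k (mul id D s m)) (expand-symSummary x (λ eq → c (here eq)))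
           (trans (cong (clamp k) (expand-rhsSummary xs (c ∘ there))) (clamp-idem _)) ⟩
    clamp k (mul id D (clamp k (summarize D (symVal 𝔸 x))) (clamp k (summarize D (concatMap (symVal 𝔸) xs))))
      ≡⟨ clamp-mul id D (summarize D (symVal 𝔸 x)) _ ⟩
    clamp k (mul id D (summarize D (symVal 𝔸 x)) (summarize D (concatMap (symVal 𝔸) xs)))
      ≡⟨ cong (clamp k) (summarize-++ D (symVal 𝔸 x) _) ⟨
    clamp k (summarize D (symVal 𝔸 x ++ concatMap (symVal 𝔸) xs)) ∎
    where
    open ≡-Reasoning
    s = symSummary τ x
    m = rhsSummary D τ xs

  -- The side condition speaks of the nonterminals occurring in X and not of X itself, so the
  -- induction can be started at the start nonterminal.
  correctness : ∀ X → Acc _OccursIn_ X → (∀ {Y} → Y OccursIn X → TransClosure _OccursIn_ Y (start 𝔸)) → Correct X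
  correctness X (acc rec) below = begin
    expand ε (τ X)
      ≡⟨ cong (expand ε) (τ-fixed X) ⟩
    expand ε (rhsSummary D τ (rhs X))
      ≡⟨ expand-rhsSummary (rhs X) (λ {Y} Y∈ → below Y∈ , correctness Y (rec Y∈) (_∷ below Y∈)) ⟩
    clamp k (summarize D (concatMap (symVal 𝔸) (rhs X)))
      ≡⟨ cong (clamp k ∘ summarize D) (valₙ-unfold 𝔸 X) ⟨
    clamp k (summarize D (valₙ X)) ∎
    where open ≡-Reasoning

  decode-correct : ∀ a w → (∀ {b} → b ∈ a ∷ w → b ∈ D) → val 𝔸 ≡ concatMap (encodeLetter D) (a ∷ w) → val 𝔻 ≡ a ∷ w
  decode-correct a w w⊆D val≡ = begin
    val 𝔻
      ≡⟨ valₙ-unfold 𝔻 (start 𝔸) ⟩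
    concatMap ε (toList (rhs′ (start 𝔸)))
      ≡⟨ cong (λ b → concatMap ε (toList (Bool.if b then inj₂ (at D p) ∷ u else orJunk u))) (≡ᵇ-refl (toℕ (start 𝔸))) ⟩
    at D p ∷ concatMap ε u
      ≡⟨ cong (λ (_ , p , _ , v) → at D p ∷ v) summary≡ ⟩
    at D (k ⊓ index D a) ∷ w
      ≡⟨ cong (_∷ w) (trans (at-⊓ D (index D a)) (at-index D (w⊆D (here refl)))) ⟩
    a ∷ w ∎
    where
    open ≡-Reasoning
    p = proj₁ (proj₂ (τ (start 𝔸)))
    u = middle (τ (start 𝔸))
    summary≡ : expand ε (τ (start 𝔸)) ≡ clamp k (true , index D a , 0 , w)
    summary≡ = trans (correctness (start 𝔸) (OccursIn-wellFounded _) Plus.[_])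
      (cong (clamp k) (trans (cong (summarize D) val≡) (summarize-encoding D a w (w⊆D ∘ there))))

  length-rhs′ : ∀ X → List⁺.length (rhs′ X) ≤ List⁺.length (prod 𝔸 X) + List⁺.length (prod 𝔸 X)
  length-rhs′ X = ≤-trans (bound (toℕ X ≡ᵇ toℕ (start 𝔸)))
    (subst (λ m → suc (length (middle m)) ≤ _) (sym (τ-fixed X)) (length-rhsSummary D τ (List⁺.head (prod 𝔸 X)) (List⁺.tail (prod 𝔸 X))))
    where
    length-orJunk : ∀ u → List⁺.length (orJunk u) ≤ suc (length u)
    length-orJunk []      = ≤-refl
    length-orJunk (x ∷ u) = n≤1+n _

    bound : ∀ b {a} → List⁺.length (Bool.if b then inj₂ a ∷ middle (τ X) else orJunk (middle (τ X))) ≤ suc (length (middle (τ X)))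
    bound true  = ≤-refl
    bound false = length-orJunk (middle (τ X))

  decode-size : size 𝔻 ≤ size 𝔸 + size 𝔸
  decode-size = sums (allFin N)
    where
    sums : ∀ Xs → sum (map (List⁺.length ∘ rhs′) Xs) ≤ sum (map (List⁺.length ∘ prod 𝔸) Xs) + sum (map (List⁺.length ∘ prod 𝔸) Xs)
    sums []       = z≤n
    sums (X ∷ Xs) = ≤-trans (+-mono-≤ (length-rhs′ X) (sums Xs))
      (≤-reflexive (interchange +-commutativeSemigroup (List⁺.length (prod 𝔸 X)) _ _ _))

-- The number of letters of a word

unique⇒lookup-injective : ∀ {xs : List V} → Unique xs → ∀ i j → List.lookup xs i ≡ List.lookup xs j → i ≡ j
unique⇒lookup-injective (_ ∷ _)  zero    zero    eq = refl
unique⇒lookup-injective (x∉ ∷ _) zero    (suc j) eq = contradiction eq (All.lookup x∉ (∈-lookup j))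
unique⇒lookup-injective (x∉ ∷ _) (suc i) zero    eq = contradiction (sym eq) (All.lookup x∉ (∈-lookup i))
unique⇒lookup-injective (_ ∷ u)  (suc i) (suc j) eq = cong suc (unique⇒lookup-injective u i j eq)

unique-⊆⇒length≤ : ∀ {xs ys : List V} → Unique xs → (∀ {x} → x ∈ xs → x ∈ ys) → length xs ≤ length ys
unique-⊆⇒length≤ {xs = xs} {ys} u xs⊆ys = Fin.injective⇒≤ {f = position} λ {i} {j} eq →
  unique⇒lookup-injective u i j (trans (lookup-index (xs⊆ys (∈-lookup i)))
    (trans (cong (List.lookup ys) eq) (sym (lookup-index (xs⊆ys (∈-lookup j))))))
  where
  position : Fin (length xs) → Fin (length ys)
  position i = Any.index (xs⊆ys (∈-lookup i))

module _ (𝔸 : SLP V) where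
  open SLP 𝔸 using (_OccursIn_; valₙ; OccursIn-wellFounded)

  ∈-valₙ : ∀ {a} X → Acc _OccursIn_ X → a ∈ valₙ X → ∃[ Y ] inj₂ a ∈ toList (prod 𝔸 Y)
  ∈-valₙ {a} X (acc rec) a∈ with find (∈-concatMap⁻ (symVal 𝔸) {xs = toList (prod 𝔸 X)} (subst (a ∈_) (valₙ-unfold 𝔸 X) a∈))
  ... | inj₁ Y , Y∈ , a∈Y      = ∈-valₙ Y (rec Y∈) a∈Y
  ... | inj₂ b , b∈ , here refl = X , b∈

  symbols : List (Fin (nonterminals 𝔸) ⊎ V)
  symbols = concatMap (toList ∘ prod 𝔸) (allFin _)

  length-symbols : length symbols ≡ size 𝔸
  length-symbols = lengths (allFin _)
    where
    lengths : ∀ Xs → length (concatMap (toList ∘ prod 𝔸) Xs) ≡ sum (map (List⁺.length ∘ prod 𝔸) Xs)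
    lengths []       = refl
    lengths (X ∷ Xs) = trans (List.length-++ (toList (prod 𝔸 X))) (cong (List⁺.length (prod 𝔸 X) +_) (lengths Xs))

  -- Every letter of the value is written in some right-hand side, and distinct letters take
  -- distinct places there.
  letters≤size : ∀ {D} → Unique D → (∀ {a} → a ∈ D → a ∈ val 𝔸) → length D ≤ size 𝔸
  letters≤size {D} u D⊆ = begin
    length D            ≡⟨ List.length-map inj₂ D ⟨
    length (map inj₂ D) ≤⟨ unique-⊆⇒length≤ (Unique.map⁺ inj₂-injective u) D⊆symbols ⟩
    length symbols      ≡⟨ length-symbols ⟩
    size 𝔸              ∎
    where
    open ≤-Reasoning hiding (start)
    D⊆symbols : ∀ {x} → x ∈ map inj₂ D → x ∈ symbols
    D⊆symbols x∈ with ∈-map⁻ inj₂ x∈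
    ... | a , a∈ , refl = let (Y , a∈Y) = ∈-valₙ (start 𝔸) (OccursIn-wellFounded _) (D⊆ a∈) in
      ∈-concatMap⁺ (toList ∘ prod 𝔸) (Any.map (λ { refl → a∈Y }) (∈-allFin Y))

-- Replacing letters by blocks

sum-tabulate-+ : ∀ m {n} (f : Fin (m + n) → ℕ) →
  sum (tabulate f) ≡ sum (tabulate (f ∘ (_↑ˡ n))) + sum (tabulate (f ∘ (m ↑ʳ_)))
sum-tabulate-+ zero    f = refl
sum-tabulate-+ (suc m) f = trans (cong (f zero +_) (sum-tabulate-+ m (f ∘ suc))) (sym (+-assoc (f zero) _ _))

sum-tabulate-≤ : ∀ n c (f : Fin n → ℕ) → (∀ i → f i ≤ c) → sum (tabulate f) ≤ n * c
sum-tabulate-≤ zero    c f f≤c = z≤n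
sum-tabulate-≤ (suc n) c f f≤c = +-mono-≤ (f≤c zero) (sum-tabulate-≤ n c (f ∘ suc) (f≤c ∘ suc))

module Encode (𝔸 : SLP Letter) (k : ℕ) (idx : Letter → Fin k) where
  open SLP 𝔸 using (_OccursIn_; valₙ; OccursIn-wellFounded)

  N : ℕ
  N = nonterminals 𝔸

  sym⁺ : Fin N ⊎ Letter → Fin (N + k) ⊎ Letter
  sym⁺ (inj₁ Y) = inj₁ (Y ↑ˡ k)
  sym⁺ (inj₂ a) = inj₁ (N ↑ʳ idx a)

  block : ∀ {n} → Fin n → List⁺ (Fin n ⊎ Letter)
  block zero    = inj₂ 2 ∷ []
  block (suc i) = inj₂ 1 ∷ inj₁ (inject₁ i) ∷ []

  embed : Fin k ⊎ Letter → Fin (N + k) ⊎ Letter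
  embed = Sum.map₁ (N ↑ʳ_)

  rule : Fin N ⊎ Fin k → List⁺ (Fin (N + k) ⊎ Letter)
  rule (inj₁ X) = List⁺.map sym⁺ (prod 𝔸 X)
  rule (inj₂ i) = List⁺.map embed (block i)

  prod⁺ : Fin (N + k) → List⁺ (Fin (N + k) ⊎ Letter)
  prod⁺ Z = rule (splitAt N Z)

  prod⁺-↑ˡ : ∀ X → prod⁺ (X ↑ˡ k) ≡ rule (inj₁ X)
  prod⁺-↑ˡ X = cong rule (Fin.splitAt-↑ˡ N X k)

  prod⁺-↑ʳ : ∀ i → prod⁺ (N ↑ʳ i) ≡ rule (inj₂ i)
  prod⁺-↑ʳ i = cong rule (Fin.splitAt-↑ʳ N k i)

  _Occurs⁺In_ : Fin (N + k) → Fin (N + k) → Set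
  Y Occurs⁺In X = inj₁ Y ∈ toList (prod⁺ X)

  -- The recursion runs on the number n, since `inject₁ i` is not a subterm of `suc i`; `val-↑ʳ`
  -- recurses in the same way.
  accessible-↑ʳ : ∀ n i → toℕ i ≡ n → Acc _Occurs⁺In_ (N ↑ʳ i)
  accessible-↑ʳ n i eq = acc λ {Y} Y∈ → below n i eq (subst (λ r → inj₁ Y ∈ toList r) (prod⁺-↑ʳ i) Y∈)
    where
    below : ∀ n i → toℕ i ≡ n → ∀ {Y} → inj₁ Y ∈ toList (rule (inj₂ i)) → Acc _Occurs⁺In_ Y
    below n       zero    eq (here ())
    below n       zero    eq (there ())
    below (suc n) (suc i) eq (there (here refl)) = accessible-↑ʳ n (inject₁ i) (trans (Fin.toℕ-inject₁ i) (suc-injective eq))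

  accessible-↑ˡ : ∀ X → Acc _OccursIn_ X → Acc _Occurs⁺In_ (X ↑ˡ k)
  accessible-↑ˡ X (acc rec) = acc λ {Y} Y∈ → below (∈-map⁻ sym⁺ (subst (λ r → inj₁ Y ∈ toList r) (prod⁺-↑ˡ X) Y∈))
    where
    below : ∀ {Y} → (∃[ x ] x ∈ toList (prod 𝔸 X) × inj₁ Y ≡ sym⁺ x) → Acc _Occurs⁺In_ Y
    below (inj₁ Z , Z∈ , refl) = accessible-↑ˡ Z (rec Z∈)
    below (inj₂ a , a∈ , refl) = accessible-↑ʳ _ (idx a) refl

  Occurs⁺In-wellFounded : WellFounded _Occurs⁺In_
  Occurs⁺In-wellFounded Z with splitAt N Z in eq
  ... | inj₁ X = subst (Acc _Occurs⁺In_) (Fin.splitAt⁻¹-↑ˡ eq) (accessible-↑ˡ X (OccursIn-wellFounded X))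
  ... | inj₂ i = subst (Acc _Occurs⁺In_) (Fin.splitAt⁻¹-↑ʳ {m = N} eq) (accessible-↑ʳ _ i refl)

  𝔼 : SLP Letter
  𝔼 = record
    { nonterminals = N + k
    ; start        = start 𝔸 ↑ˡ k
    ; prod         = prod⁺
    ; acyclic      = wellFounded⇒acyclic Occurs⁺In-wellFounded
    }

  code⁺ : Letter → List Letter
  code⁺ a = List.replicate (toℕ (idx a)) 1 ++ [ 2 ]

  val-↑ʳ : ∀ n i → toℕ i ≡ n → SLP.valₙ 𝔼 (N ↑ʳ i) ≡ List.replicate n 1 ++ [ 2 ]
  val-↑ʳ n i eq = trans (valₙ-unfold 𝔼 (N ↑ʳ i)) (trans (cong (concatMap (symVal 𝔼) ∘ toList) (prod⁺-↑ʳ i)) (rules n i eq))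
    where
    rules : ∀ n i → toℕ i ≡ n → concatMap (symVal 𝔼) (toList (rule (inj₂ i))) ≡ List.replicate n 1 ++ [ 2 ]
    rules zero    zero    eq = refl
    rules (suc n) (suc i) eq = cong (1 ∷_) (trans (List.++-identityʳ _)
      (val-↑ʳ n (inject₁ i) (trans (Fin.toℕ-inject₁ i) (suc-injective eq))))

  val-↑ˡ : ∀ X → Acc _OccursIn_ X → SLP.valₙ 𝔼 (X ↑ˡ k) ≡ concatMap code⁺ (valₙ X)
  val-↑ˡ X (acc rec) = begin
    SLP.valₙ 𝔼 (X ↑ˡ k)
      ≡⟨ valₙ-unfold 𝔼 (X ↑ˡ k) ⟩
    concatMap (symVal 𝔼) (toList (prod⁺ (X ↑ˡ k)))
      ≡⟨ cong (concatMap (symVal 𝔼) ∘ toList) (prod⁺-↑ˡ X) ⟩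
    concatMap (symVal 𝔼) (map sym⁺ (toList (prod 𝔸 X)))
      ≡⟨ rhs (toList (prod 𝔸 X)) id ⟩
    concatMap code⁺ (concatMap (symVal 𝔸) (toList (prod 𝔸 X)))
      ≡⟨ cong (concatMap code⁺) (valₙ-unfold 𝔸 X) ⟨
    concatMap code⁺ (valₙ X) ∎
    where
    open ≡-Reasoning
    symbol : ∀ x → x ∈ toList (prod 𝔸 X) → symVal 𝔼 (sym⁺ x) ≡ concatMap code⁺ (symVal 𝔸 x)
    symbol (inj₁ Y) Y∈ = val-↑ˡ Y (rec Y∈)
    symbol (inj₂ a) _  = trans (val-↑ʳ _ (idx a) refl) (sym (List.++-identityʳ _))

    rhs : ∀ xs → (∀ {x} → x ∈ xs → x ∈ toList (prod 𝔸 X)) →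
          concatMap (symVal 𝔼) (map sym⁺ xs) ≡ concatMap code⁺ (concatMap (symVal 𝔸) xs)
    rhs []       xs⊆ = refl
    rhs (x ∷ xs) xs⊆ = trans (cong₂ _++_ (symbol x (xs⊆ (here refl))) (rhs xs (xs⊆ ∘ there)))
      (sym (List.concatMap-++ code⁺ (symVal 𝔸 x) _))

  encode-val : val 𝔼 ≡ concatMap code⁺ (val 𝔸)
  encode-val = val-↑ˡ (start 𝔸) (OccursIn-wellFounded _)

  encode-size : size 𝔼 ≤ size 𝔸 + k * 2
  encode-size = begin
    sum (map len⁺ (allFin (N + k)))
      ≡⟨ cong sum (List.map-tabulate id len⁺) ⟩
    sum (tabulate len⁺)
      ≡⟨ sum-tabulate-+ N len⁺ ⟩
    sum (tabulate (len⁺ ∘ (_↑ˡ k))) + sum (tabulate (len⁺ ∘ (N ↑ʳ_)))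
      ≤⟨ +-mono-≤ (≤-reflexive (cong sum (List.tabulate-cong length-↑ˡ))) (sum-tabulate-≤ k 2 _ length-↑ʳ) ⟩
    sum (tabulate (List⁺.length ∘ prod 𝔸)) + k * 2
      ≡⟨ cong (λ l → sum l + k * 2) (List.map-tabulate id (List⁺.length ∘ prod 𝔸)) ⟨
    size 𝔸 + k * 2 ∎
    where
    open ≤-Reasoning
    len⁺ : Fin (N + k) → ℕ
    len⁺ = List⁺.length ∘ prod⁺

    length-↑ˡ : ∀ X → len⁺ (X ↑ˡ k) ≡ List⁺.length (prod 𝔸 X)
    length-↑ˡ X = trans (cong List⁺.length (prod⁺-↑ˡ X)) (cong suc (List.length-map sym⁺ (List⁺.tail (prod 𝔸 X))))

    length-block : ∀ {n} (i : Fin n) → List⁺.length (block i) ≤ 2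
    length-block zero    = s≤s z≤n
    length-block (suc i) = ≤-refl

    length-↑ʳ : ∀ i → len⁺ (N ↑ʳ i) ≤ 2
    length-↑ʳ i = ≤-trans (≤-reflexive (trans (cong List⁺.length (prod⁺-↑ʳ i)) (cong suc (List.length-map embed (List⁺.tail (block i)))))) (length-block i)

encode : ∀ 𝔸 a w → val 𝔸 ≡ a ∷ w →
  ∃[ 𝔼 ] val 𝔼 ≡ concatMap (encodeLetter (dedup (a ∷ w))) (a ∷ w) × size 𝔼 ≤ 3 * size 𝔸
encode 𝔸 a w val≡ = 𝔼 , val-𝔼 , size-𝔼
  where
  D : List Letter
  D = dedup (a ∷ w)

  idx : Letter → Fin (length D)
  idx b with index D b <? length D
  ... | yes b< = fromℕ< b<
  -- Rules of unreachable nonterminals may mention letters outside the word; these are encoded like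
  -- its first letter.
  ... | no _   = fromℕ< (index< D (∈-dedup⁺ (a ∷ w) (here refl)))

  toℕ-idx : ∀ {b} → b ∈ D → toℕ (idx b) ≡ index D b
  toℕ-idx {b} b∈ with index D b <? length D
  ... | yes b< = Fin.toℕ-fromℕ< b<
  ... | no b≮  = contradiction (index< D b∈) b≮

  open Encode 𝔸 (length D) idx

  val-𝔼 : val 𝔼 ≡ concatMap (encodeLetter D) (a ∷ w)
  val-𝔼 = trans encode-val (trans (cong (concatMap code⁺) val≡) (concatMap-cong-∈ (a ∷ w)
    λ b∈ → cong (λ n → List.replicate n 1 ++ [ 2 ]) (toℕ-idx (∈-dedup⁺ (a ∷ w) b∈))))

  size-𝔼 : size 𝔼 ≤ 3 * size 𝔸
  size-𝔼 = begin
    size 𝔼                 ≤⟨ encode-size ⟩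
    size 𝔸 + length D * 2  ≤⟨ +-monoʳ-≤ (size 𝔸) (*-monoˡ-≤ 2 (letters≤size 𝔸 (dedup-unique (a ∷ w))
                                (λ {b} b∈ → subst (b ∈_) (sym val≡) (∈-dedup⁻ (a ∷ w) b∈)))) ⟩
    size 𝔸 + size 𝔸 * 2    ≡⟨ cong (size 𝔸 +_) (*-comm (size 𝔸) 2) ⟩
    3 * size 𝔸             ∎
    where open ≤-Reasoning

private variable
  k m n t : ℕ

-- Polynomials

infixl 6 _⊞_
infixl 7 _⊠_
infixr 9 _⊚_
-- Natural coefficients make every polynomial monotone, so time bounds can be composed freely. Only
-- `monomial-bound` brings them into the form that `PolyTime` asks for.
data Pol : Set where
  𝐱       : Pol
  K       : ℕ → Pol
  _⊞_ _⊠_ : Pol → Pol → Pol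

⟦_⟧ : Pol → ℕ → ℕ
⟦ 𝐱 ⟧     n = n
⟦ K c ⟧   n = c
⟦ p ⊞ q ⟧ n = ⟦ p ⟧ n + ⟦ q ⟧ n
⟦ p ⊠ q ⟧ n = ⟦ p ⟧ n * ⟦ q ⟧ n

⟦⟧-mono : ∀ p → m ≤ n → ⟦ p ⟧ m ≤ ⟦ p ⟧ n
⟦⟧-mono 𝐱       m≤n = m≤n
⟦⟧-mono (K c)   m≤n = ≤-refl
⟦⟧-mono (p ⊞ q) m≤n = +-mono-≤ (⟦⟧-mono p m≤n) (⟦⟧-mono q m≤n)
⟦⟧-mono (p ⊠ q) m≤n = *-mono-≤ (⟦⟧-mono p m≤n) (⟦⟧-mono q m≤n)

_⊚_ : Pol → Pol → Pol
𝐱       ⊚ r = r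
K c     ⊚ r = K c
(p ⊞ q) ⊚ r = p ⊚ r ⊞ q ⊚ r
(p ⊠ q) ⊚ r = p ⊚ r ⊠ q ⊚ r

⟦⊚⟧ : ∀ p r n → ⟦ p ⊚ r ⟧ n ≡ ⟦ p ⟧ (⟦ r ⟧ n)
⟦⊚⟧ 𝐱       r n = refl
⟦⊚⟧ (K c)   r n = refl
⟦⊚⟧ (p ⊞ q) r n = cong₂ _+_ (⟦⊚⟧ p r n) (⟦⊚⟧ q r n)
⟦⊚⟧ (p ⊠ q) r n = cong₂ _*_ (⟦⊚⟧ p r n) (⟦⊚⟧ q r n)

⟦⟧-⊚ : ∀ p r → m ≤ ⟦ r ⟧ n → ⟦ p ⟧ m ≤ ⟦ p ⊚ r ⟧ n
⟦⟧-⊚ {m} {n} p r m≤ = subst (⟦ p ⟧ m ≤_) (sym (⟦⊚⟧ p r n)) (⟦⟧-mono p m≤)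

-- At positive arguments powers grow with the exponent, so both summands of a sum can be raised to
-- the common exponent d + e. Sizes of trees are always positive.
monomial-bound : ∀ p → ∃[ a ] ∃[ d ] ∀ n → ⟦ p ⟧ (suc n) ≤ a * suc n ^ d
monomial-bound 𝐱     = 1 , 1 , λ n → ≤-reflexive (sym (trans (*-identityˡ _) (*-identityʳ (suc n))))
monomial-bound (K c) = c , 0 , λ n → ≤-reflexive (sym (*-identityʳ c))
monomial-bound (p ⊞ q) with monomial-bound p | monomial-bound q
... | a , d , p≤ | b , e , q≤ = a + b , d + e , λ n → begin
  ⟦ p ⟧ (suc n) + ⟦ q ⟧ (suc n)
    ≤⟨ +-mono-≤ (p≤ n) (q≤ n) ⟩
  a * suc n ^ d + b * suc n ^ e
    ≤⟨ +-mono-≤ (*-monoʳ-≤ a (^-monoʳ-≤ (suc n) (m≤m+n d e))) (*-monoʳ-≤ b (^-monoʳ-≤ (suc n) (m≤n+m e d))) ⟩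
  a * suc n ^ (d + e) + b * suc n ^ (d + e)
    ≡⟨ *-distribʳ-+ (suc n ^ (d + e)) a b ⟨
  (a + b) * suc n ^ (d + e) ∎
  where open ≤-Reasoning
monomial-bound (p ⊠ q) with monomial-bound p | monomial-bound q
... | a , d , p≤ | b , e , q≤ = a * b , d + e , λ n → begin
  ⟦ p ⟧ (suc n) * ⟦ q ⟧ (suc n)
    ≤⟨ *-mono-≤ (p≤ n) (q≤ n) ⟩
  (a * suc n ^ d) * (b * suc n ^ e)
    ≡⟨ [m*n]*[o*p]≡[m*o]*[n*p] a (suc n ^ d) b (suc n ^ e) ⟩
  a * b * (suc n ^ d * suc n ^ e)
    ≡⟨ cong (a * b *_) (^-distribˡ-+-* (suc n) d e) ⟨
  a * b * suc n ^ (d + e) ∎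
  where open ≤-Reasoning

_^ₚ_ : Pol → ℕ → Pol
p ^ₚ zero  = K 1
p ^ₚ suc d = p ⊠ p ^ₚ d

⟦^ₚ⟧ : ∀ p d n → ⟦ p ^ₚ d ⟧ n ≡ ⟦ p ⟧ n ^ d
⟦^ₚ⟧ p zero    n = refl
⟦^ₚ⟧ p (suc d) n = cong (⟦ p ⟧ n *_) (⟦^ₚ⟧ p d n)

-- Depth of trees

-- A running time is polynomial in the depth of the trees involved: since a
-- store is a dag, the size of a tree may be exponential in the running time,
-- whereas a step increases the depth only by a constant.
depth : Tree → ℕ
depth nil     = 0
depth (s ∙ t) = suc (depth s ⊔ depth t)

depth<size : ∀ t → suc (depth t) ≤ ∣ t ∣ᵗ
depth<size nil     = ≤-refl
depth<size (s ∙ t) = s≤s (⊔-lub (≤-trans (depth<size s) (m≤m+n _ _)) (≤-trans (depth<size t) (m≤n+m _ _)))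

depth-hd : ∀ t → depth (hdᵗ t) ≤ depth t
depth-hd nil     = ≤-refl
depth-hd (s ∙ t) = m≤n⇒m≤1+n (m≤m⊔n _ _)

depth-tl : ∀ t → depth (tlᵗ t) ≤ depth t
depth-tl nil     = ≤-refl
depth-tl (s ∙ t) = m≤n⇒m≤1+n (m≤n⊔m _ _)

storeDepth : Store k → ℕ
storeDepth = Vec.foldr _ (λ t → depth t ⊔_) 0

depth-lookup : ∀ (σ : Store k) x → depth (lookup σ x) ≤ storeDepth σ
depth-lookup (t ∷ σ) zero    = m≤m⊔n _ _
depth-lookup (t ∷ σ) (suc x) = ≤-trans (depth-lookup σ x) (m≤n⊔m _ _)

depth-eval : ∀ (e : Expr k) σ → depth (eval e σ) ≤ storeDepth σ + cost e
depth-eval (var x)    σ = ≤-trans (depth-lookup σ x) (m≤m+n _ _)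
depth-eval nil        σ = z≤n
depth-eval (cons e f) σ = begin
  suc (depth (eval e σ) ⊔ depth (eval f σ))
    ≤⟨ s≤s (⊔-lub (≤-trans (depth-eval e σ) (+-monoʳ-≤ (storeDepth σ) (m≤m+n _ _))) (≤-trans (depth-eval f σ) (+-monoʳ-≤ (storeDepth σ) (m≤n+m _ _)))) ⟩
  suc (storeDepth σ + (cost e + cost f))
    ≡⟨ +-suc _ _ ⟨
  storeDepth σ + suc (cost e + cost f) ∎
  where open ≤-Reasoning
depth-eval (hd e)     σ = ≤-trans (depth-hd (eval e σ)) (≤-trans (depth-eval e σ) (+-monoʳ-≤ _ (n≤1+n _)))
depth-eval (tl e)     σ = ≤-trans (depth-tl (eval e σ)) (≤-trans (depth-eval e σ) (+-monoʳ-≤ _ (n≤1+n _)))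

storeDepth-update : ∀ (σ : Store k) x v → storeDepth (σ [ x ]≔ v) ≤ storeDepth σ ⊔ depth v
storeDepth-update (t ∷ σ) zero    v = ⊔-lub (m≤n⊔m (depth t ⊔ storeDepth σ) (depth v)) (≤-trans (m≤n⊔m (depth t) (storeDepth σ)) (m≤m⊔n _ (depth v)))
storeDepth-update (t ∷ σ) (suc x) v = ⊔-lub
  (≤-trans (m≤m⊔n (depth t) (storeDepth σ)) (m≤m⊔n _ _))
  (≤-trans (storeDepth-update σ x v) (⊔-monoˡ-≤ (depth v) (m≤n⊔m (depth t) (storeDepth σ))))

storeDepth-⇓ : ∀ {c : Cmd k} {σ τ} → ⟨ c , σ ⟩⇓[ t ] τ → storeDepth τ ≤ storeDepth σ + t
storeDepth-⇓ ⇓skip = m≤m+n _ _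
storeDepth-⇓ (⇓:= {x} {e} {σ}) = ≤-trans (storeDepth-update σ x _)
  (⊔-lub (m≤m+n _ _) (≤-trans (depth-eval e σ) (+-monoʳ-≤ (storeDepth σ) (n≤1+n _))))
storeDepth-⇓ (⇓⨾ {σ = σ} {s = s} {t} ⇓c ⇓d) =
  ≤-trans (storeDepth-⇓ ⇓d) (≤-trans (+-monoˡ-≤ t (storeDepth-⇓ ⇓c)) (≤-reflexive (+-assoc (storeDepth σ) s t)))
storeDepth-⇓ (⇓then {σ = σ} _ ⇓c) = ≤-trans (storeDepth-⇓ ⇓c) (+-monoʳ-≤ (storeDepth σ) (m≤n+m _ _))
storeDepth-⇓ (⇓else {σ = σ} _ ⇓c) = ≤-trans (storeDepth-⇓ ⇓c) (+-monoʳ-≤ (storeDepth σ) (m≤n+m _ _))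
storeDepth-⇓ (⇓loop {e} {σ = σ} {s = s} {t} _ ⇓c ⇓d) = ≤-trans (storeDepth-⇓ ⇓d)
  (≤-trans (+-monoˡ-≤ t (storeDepth-⇓ ⇓c))
  (≤-trans (≤-reflexive (+-assoc (storeDepth σ) s t)) (+-monoʳ-≤ (storeDepth σ) (m≤n+m (s + t) (suc (cost e))))))
storeDepth-⇓ (⇓exit _) = m≤m+n _ _

storeDepth-nil : ∀ k → storeDepth (replicate k nil) ≡ 0
storeDepth-nil zero    = refl
storeDepth-nil (suc k) = storeDepth-nil k

-- Renaming of variables

renameᵉ : (Fin m → Fin n) → Expr m → Expr n
renameᵉ ρ (var x)    = var (ρ x)
renameᵉ ρ nil        = nil
renameᵉ ρ (cons e f) = cons (renameᵉ ρ e) (renameᵉ ρ f)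
renameᵉ ρ (hd e)     = hd (renameᵉ ρ e)
renameᵉ ρ (tl e)     = tl (renameᵉ ρ e)

rename : (Fin m → Fin n) → Cmd m → Cmd n
rename ρ skip                 = skip
rename ρ (x := e)             = ρ x := renameᵉ ρ e
rename ρ (c ⨾ d)              = rename ρ c ⨾ rename ρ d
rename ρ (if e then c else d) = if renameᵉ ρ e then rename ρ c else rename ρ d
rename ρ (while e loop c)     = while renameᵉ ρ e loop rename ρ c

module _ (i : Fin (suc m)) (v : Tree) where

  eval-punchIn : ∀ e (σ : Store m) → eval (renameᵉ (punchIn i) e) (insertAt σ i v) ≡ eval e σ
  eval-punchIn (var x)    σ = insertAt-punchIn σ i v x
  eval-punchIn nil        σ = refl
  eval-punchIn (cons e f) σ = cong₂ _∙_ (eval-punchIn e σ) (eval-punchIn f σ)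
  eval-punchIn (hd e)     σ = cong hdᵗ (eval-punchIn e σ)
  eval-punchIn (tl e)     σ = cong tlᵗ (eval-punchIn e σ)

  cost-rename : (e : Expr m) → cost (renameᵉ (punchIn i) e) ≡ cost e
  cost-rename (var x)    = refl
  cost-rename nil        = refl
  cost-rename (cons e f) = cong suc (cong₂ _+_ (cost-rename e) (cost-rename f))
  cost-rename (hd e)     = cong suc (cost-rename e)
  cost-rename (tl e)     = cong suc (cost-rename e)

insertAt-update : ∀ (σ : Store m) i v x w → insertAt σ i v [ punchIn i x ]≔ w ≡ insertAt (σ [ x ]≔ w) i v
insertAt-update σ       zero    v x       w = refl
insertAt-update (_ ∷ σ) (suc i) v zero    w = refl
insertAt-update (u ∷ σ) (suc i) v (suc x) w = cong (u ∷_) (insertAt-update σ i v x w)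

-- The renamed command neither reads nor writes the inserted variable. This lets a program run
-- beside the stack, and lets `clear` act on a part of the store.
⇓-punchIn : ∀ i v {c : Cmd m} {σ τ} → ⟨ c , σ ⟩⇓[ t ] τ →
            ⟨ rename (punchIn i) c , insertAt σ i v ⟩⇓[ t ] insertAt τ i v
⇓-punchIn i v ⇓skip = ⇓skip
⇓-punchIn i v (⇓:= {x} {e} {σ}) =
  subst (⟨ _ , _ ⟩⇓[ suc (cost e) ]_) (trans (cong (insertAt σ i v [ punchIn i x ]≔_) (eval-punchIn i v e σ)) (insertAt-update σ i v x _))
    (subst (λ c → ⟨ punchIn i x := renameᵉ (punchIn i) e , insertAt σ i v ⟩⇓[ suc c ] (insertAt σ i v [ punchIn i x ]≔ eval (renameᵉ (punchIn i) e) (insertAt σ i v))) (cost-rename i v e) ⇓:=)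
⇓-punchIn i v (⇓⨾ ⇓c ⇓d) = ⇓⨾ (⇓-punchIn i v ⇓c) (⇓-punchIn i v ⇓d)
⇓-punchIn i v (⇓then {e} {t = t} b ⇓c) rewrite sym (cost-rename i v e) =
  ⇓then (subst True (sym (eval-punchIn i v e _)) b) (⇓-punchIn i v ⇓c)
⇓-punchIn i v (⇓else {e} b ⇓c) rewrite sym (cost-rename i v e) =
  ⇓else (trans (eval-punchIn i v e _) b) (⇓-punchIn i v ⇓c)
⇓-punchIn i v (⇓loop {e} b ⇓c ⇓d) rewrite sym (cost-rename i v e) =
  ⇓loop (subst True (sym (eval-punchIn i v e _)) b) (⇓-punchIn i v ⇓c) (⇓-punchIn i v ⇓d)
⇓-punchIn i v (⇓exit {e} b) rewrite sym (cost-rename i v e) = ⇓exit (trans (eval-punchIn i v e _) b)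

clear : ∀ k → Cmd k
clear zero    = skip
clear (suc k) = (zero := nil) ⨾ rename suc (clear k)

clearTime : ℕ → ℕ
clearTime zero    = 1
clearTime (suc k) = 2 + clearTime k

⇓clear : ∀ (σ : Store k) → ⟨ clear k , σ ⟩⇓[ clearTime k ] replicate k nil
⇓clear []      = ⇓skip
⇓clear (t ∷ σ) = ⇓⨾ ⇓:= (⇓-punchIn zero nil (⇓clear σ))

m∸[m∸n]≡m⊓n : ∀ m n → m ∸ (m ∸ n) ≡ m ⊓ n
m∸[m∸n]≡m⊓n zero    n       = 0∸n≡0 (0 ∸ n)
m∸[m∸n]≡m⊓n (suc m) zero    = n∸n≡0 m
m∸[m∸n]≡m⊓n (suc m) (suc n) = trans (+-∸-assoc 1 (m∸n≤m m n)) (cong suc (m∸[m∸n]≡m⊓n m n))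

-- Encoded data types

record Code : Set₁ where
  constructor code
  field
    {Carrier} : Set
    enc       : Carrier → Tree
open Code

infixr 7 _⊗_
_⊗_ : Code → Code → Code
A ⊗ B = code λ ((x , y) : Carrier A × Carrier B) → enc A x ∙ enc B y

encBool : Bool → Tree
encBool false = nil
encBool true  = nil ∙ nil

encSum : ∀ A B → Carrier A ⊎ Carrier B → Tree
encSum A B (inj₁ x) = encBool false ∙ enc A x
encSum A B (inj₂ y) = encBool true ∙ enc B y

infixr 6 _⊕_
_⊕_ : Code → Code → Code
A ⊕ B = code (encSum A B)

𝟙 𝔹 𝕌 : Code
𝟙 = code {⊤} λ _ → nil
𝔹 = code encBool
𝕌 = code encUnary

𝕃 : Code → Code
𝕃 A = code (encList (enc A))

depthOf : ∀ A → Carrier A → ℕ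
depthOf A x = depth (enc A x)

depth-unary : ∀ n → depthOf 𝕌 n ≡ n
depth-unary zero    = refl
depth-unary (suc n) = cong suc (depth-unary n)

length≤depth : ∀ A xs → length xs ≤ depthOf (𝕃 A) xs
length≤depth A []       = z≤n
length≤depth A (x ∷ xs) = s≤s (≤-trans (length≤depth A xs) (m≤n⊔m _ _))

depth-prefix : ∀ A xs ys → depthOf (𝕃 A) xs ≤ depthOf (𝕃 A) (xs ++ ys)
depth-prefix A []       ys = z≤n
depth-prefix A (x ∷ xs) ys = s≤s (⊔-monoʳ-≤ (depthOf A x) (depth-prefix A xs ys))

depth-++ : ∀ A xs ys → depthOf (𝕃 A) (xs ++ ys) ≤ depthOf (𝕃 A) xs + depthOf (𝕃 A) ys
depth-++ A []       ys = ≤-refl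
depth-++ A (x ∷ xs) ys = s≤s (⊔-lub (≤-trans (m≤m⊔n _ _) (m≤m+n _ _))
  (≤-trans (depth-++ A xs ys) (+-monoˡ-≤ (depthOf (𝕃 A) ys) (m≤n⊔m (depthOf A x) _))))

depth-∈ : ∀ A {x xs} → x ∈ xs → depthOf A x ≤ depthOf (𝕃 A) xs
depth-∈ A (here refl) = m≤n⇒m≤1+n (m≤m⊔n _ _)
depth-∈ A (there x∈)  = m≤n⇒m≤1+n (≤-trans (depth-∈ A x∈) (m≤n⊔m _ _))

depth-list : ∀ A b xs → (∀ {x} → x ∈ xs → depthOf A x ≤ b) → depthOf (𝕃 A) xs ≤ length xs + b
depth-list A b []       x≤b = z≤n
depth-list A b (x ∷ xs) x≤b = s≤s (⊔-lub (≤-trans (x≤b (here refl)) (m≤n+m b _)) (depth-list A b xs (x≤b ∘ there)))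

-- An element lying further back counts with a larger offset, so reversal can change the depth; but
-- the length and the depth of each element are both at most the old depth.
depth-reverse : ∀ A xs → depthOf (𝕃 A) (reverse xs) ≤ depthOf (𝕃 A) xs + depthOf (𝕃 A) xs
depth-reverse A xs = ≤-trans (depth-list A (depthOf (𝕃 A) xs) (reverse xs) (depth-∈ A ∘ reverse⁻))
  (+-monoˡ-≤ _ (≤-trans (≤-reflexive (List.length-reverse xs)) (length≤depth A xs)))

depth-drop : ∀ A n xs → depthOf (𝕃 A) (drop n xs) ≤ depthOf (𝕃 A) xs
depth-drop A zero    xs       = ≤-refl
depth-drop A (suc n) []       = ≤-refl
depth-drop A (suc n) (x ∷ xs) = ≤-trans (depth-drop A n xs) (m≤n⇒m≤1+n (m≤n⊔m _ _))

-- Functions on encoded data that are computable in polynomial time.  Variable 0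
-- holds the argument and then the result, and variable 1 a stack which is
-- preserved.  The remaining k variables are nil before and after.

module Computable (k : ℕ) where

  store : Tree → Tree → Store (2 + k)
  store i s = i ∷ s ∷ replicate k nil

  record PT (A B : Code) (f : Carrier A → Carrier B) : Set where
    field
      cmd : Cmd (2 + k)
      pol : Pol
      run : ∀ x s → ∃[ t ] ⟨ cmd , store (enc A x) s ⟩⇓[ t ] store (enc B (f x)) s × t ≤ ⟦ pol ⟧ (depthOf A x)

    out : Pol
    out = 𝐱 ⊞ pol

    -- Depth grows by no more than the elapsed time, so a time bound already bounds the output. This
    -- is what allows `_<<_` to compose the polynomials.
    depth-out : ∀ x → depthOf B (f x) ≤ ⟦ out ⟧ (depthOf A x)
    depth-out x = let (t , ⇓c , t≤) = run x nil in begin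
      depthOf B (f x)                                 ≤⟨ m≤m⊔n _ _ ⟩
      storeDepth (store (enc B (f x)) nil)            ≤⟨ storeDepth-⇓ ⇓c ⟩
      storeDepth (store (enc A x) nil) + t            ≡⟨ cong (λ d → depthOf A x ⊔ d + t) (storeDepth-nil k) ⟩
      depthOf A x ⊔ 0 + t                             ≡⟨ cong (_+ t) (⊔-identityʳ _) ⟩
      depthOf A x + t                                 ≤⟨ +-monoʳ-≤ (depthOf A x) t≤ ⟩
      ⟦ out ⟧ (depthOf A x)                           ∎
      where open ≤-Reasoning

  open PT

  private variable
    A B C E Γ : Code

  %0 %1 : Expr (2 + k)
  %0 = var zero
  %1 = var (suc zero)

  recode : {f : Carrier A → Carrier B} → (∀ x → enc A x ≡ enc B (f x)) → PT A B f
  recode eq .cmd = skip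
  recode eq .pol = K 1
  recode eq .run x s = _ , subst (λ y → ⟨ skip , _ ⟩⇓[ 1 ] store y s) (eq x) ⇓skip , ≤-refl

  retarget : {f : Carrier A → Carrier B} {g : Carrier A → Carrier C} →
             PT A B f → (∀ x → enc B (f x) ≡ enc C (g x)) → PT A C g
  retarget F eq .cmd = cmd F
  retarget F eq .pol = pol F
  retarget F eq .run x s = let (t , ⇓c , t≤) = run F x s in
    t , subst (λ y → ⟨ cmd F , _ ⟩⇓[ t ] store y s) (eq x) ⇓c , t≤

  infix 5 _≗∶_
  _≗∶_ : {f g : Carrier A → Carrier B} → PT A B f → (∀ x → f x ≡ g x) → PT A B g
  _≗∶_ {B = B} F eq = retarget F (cong (enc B) ∘ eq)

  infixr 6 _<<_
  _<<_ : {f : Carrier A → Carrier B} {g : Carrier B → Carrier C} → PT B C g → PT A B f → PT A C (g ∘ f)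
  (G << F) .cmd = cmd F ⨾ cmd G
  (G << F) .pol = pol F ⊞ pol G ⊚ out F
  _<<_ {f = f} G F .run x s =
    let (t , ⇓c , t≤) = run F x s
        (u , ⇓d , u≤) = run G (f x) s
    in t + u , ⇓⨾ ⇓c ⇓d , +-mono-≤ t≤ (≤-trans u≤ (⟦⟧-⊚ (pol G) (out F) (depth-out F x)))

  assign : {f : Carrier A → Carrier B} (e : Expr (2 + k)) → (∀ x s → eval e (store (enc A x) s) ≡ enc B (f x)) → PT A B f
  assign e eq .cmd = zero := e
  assign e eq .pol = K (suc (cost e))
  assign e eq .run x s = _ , subst (λ y → ⟨ zero := e , _ ⟩⇓[ _ ] store y s) (eq x s) ⇓:= , ≤-refl

  identity : PT A A id
  identity = recode λ _ → refl

  π₁ : PT (A ⊗ B) A proj₁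
  π₁ = assign (hd %0) λ _ _ → refl

  π₂ : PT (A ⊗ B) B proj₂
  π₂ = assign (tl %0) λ _ _ → refl

  infixr 4 _&_
  -- The stack holds the argument while the first command runs and the first result while the second
  -- one runs.
  _&_ : {f : Carrier A → Carrier B} {g : Carrier A → Carrier C} → PT A B f → PT A C g → PT A (B ⊗ C) (λ x → f x , g x)
  (F & G) .cmd =
    (suc zero := cons %0 %1) ⨾ cmd F ⨾
    (zero := cons %0 (hd %1)) ⨾ (suc zero := cons (hd %0) (tl %1)) ⨾ (zero := tl %0) ⨾
    cmd G ⨾ (zero := cons (hd %1) %0) ⨾ (suc zero := tl %1)
  (F & G) .pol = K 4 ⊞ (pol F ⊞ (K 5 ⊞ (K 6 ⊞ (K 3 ⊞ (pol G ⊞ (K 5 ⊞ K 3))))))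
  _&_ F G .run x s =
    let (t , ⇓c , t≤) = run F x _
        (u , ⇓d , u≤) = run G x _
    in _ , ⇓⨾ ⇓:= (⇓⨾ ⇓c (⇓⨾ ⇓:= (⇓⨾ ⇓:= (⇓⨾ ⇓:= (⇓⨾ ⇓d (⇓⨾ ⇓:= ⇓:=)))))) ,
       +-monoʳ-≤ 4 (+-mono-≤ t≤ (+-monoʳ-≤ 14 (+-monoˡ-≤ 8 u≤)))

  quoteᵗ : Tree → Expr (2 + k)
  quoteᵗ nil     = nil
  quoteᵗ (s ∙ t) = cons (quoteᵗ s) (quoteᵗ t)

  eval-quote : ∀ t σ → eval (quoteᵗ t) σ ≡ t
  eval-quote nil     σ = refl
  eval-quote (s ∙ t) σ = cong₂ _∙_ (eval-quote s σ) (eval-quote t σ)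

  const : (y : Carrier B) → PT A B (λ _ → y)
  const {B} y = assign (quoteᵗ (enc B y)) λ x s → eval-quote (enc B y) _

  branch : {f g : Carrier A → Carrier B} → PT A B f → PT A B g →
           PT (𝔹 ⊗ A) B (λ (b , x) → Bool.if b then f x else g x)
  branch F G .cmd = if hd %0 then (zero := tl %0) ⨾ cmd F else ((zero := tl %0) ⨾ cmd G)
  branch F G .pol = K 6 ⊞ (pol F ⊞ pol G)
  branch {A} F G .run (true , x) s =
    let (t , ⇓c , t≤) = run F x s
    in _ , ⇓then true (⇓⨾ ⇓:= ⇓c) ,
       +-monoʳ-≤ 6 (m≤n⇒m≤n+o _ (≤-trans t≤ (⟦⟧-mono (pol F) (m≤n⇒m≤1+n (m≤n⊔m 1 _)))))
  branch {A} F G .run (false , x) s =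
    let (t , ⇓c , t≤) = run G x s
    in _ , ⇓else refl (⇓⨾ ⇓:= ⇓c) ,
       +-monoʳ-≤ 6 (m≤n⇒m≤o+n _ (≤-trans t≤ (⟦⟧-mono (pol G) (m≤n⇒m≤1+n (m≤n⊔m 0 _)))))

  infix 3 If_Then_Else_
  If_Then_Else_ : {b : Carrier A → Bool} {f g : Carrier A → Carrier B} →
                  PT A 𝔹 b → PT A B f → PT A B g → PT A B (λ x → Bool.if b x then f x else g x)
  If b Then F Else G = branch F G << (b & identity)

  cases : {f : Carrier (A ⊗ Γ) → Carrier C} {g : Carrier (B ⊗ Γ) → Carrier C} →
          PT (A ⊗ Γ) C f → PT (B ⊗ Γ) C g →
          PT ((A ⊕ B) ⊗ Γ) C (λ (x , γ) → [ (λ a → f (a , γ)) , (λ b → g (b , γ)) ]′ x)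
  cases {A} {Γ} {C} {B} F G .cmd =
    if hd (hd %0) then (zero := cons (tl (hd %0)) (tl %0)) ⨾ cmd G else ((zero := cons (tl (hd %0)) (tl %0)) ⨾ cmd F)
  cases F G .pol = K 11 ⊞ (pol F ⊞ pol G)
  cases {A} {Γ} F G .run (inj₁ x , γ) s =
    let (t , ⇓c , t≤) = run F (x , γ) s
    in _ , ⇓else refl (⇓⨾ ⇓:= ⇓c) ,
       +-monoʳ-≤ 11 (m≤n⇒m≤n+o _ (≤-trans t≤ (⟦⟧-mono (pol F) (s≤s (⊔-monoˡ-≤ (depthOf Γ γ) (n≤1+n _))))))
  cases {A} {Γ} {C} {B} F G .run (inj₂ x , γ) s =
    let (t , ⇓c , t≤) = run G (x , γ) s
    in _ , ⇓then true (⇓⨾ ⇓:= ⇓c) ,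
       +-monoʳ-≤ 11 (m≤n⇒m≤o+n _ (≤-trans t≤ (⟦⟧-mono (pol G) (s≤s (⊔-monoˡ-≤ (depthOf Γ γ) (m≤n⇒m≤1+n (m≤n⊔m 1 (depthOf B x))))))))

  infixr 5 _◂_
  _◂_ : {f : Carrier Γ → Carrier A} {g : Carrier Γ → List (Carrier A)} →
        PT Γ A f → PT Γ (𝕃 A) g → PT Γ (𝕃 A) (λ γ → f γ ∷ g γ)
  F ◂ G = recode (λ _ → refl) << (F & G)

  tail : PT (𝕃 A) (𝕃 A) (drop 1)
  tail = assign (tl %0) λ { [] _ → refl ; (_ ∷ _) _ → refl }

  isNull : PT (𝕃 A) 𝔹 null
  isNull .cmd = if %0 then (zero := nil) else (zero := cons nil nil)
  isNull .pol = K 6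
  isNull .run []      s = _ , ⇓else refl ⇓:= , ≤-refl
  isNull .run (_ ∷ _) s = _ , ⇓then true ⇓:= , s≤s (s≤s (s≤s (s≤s z≤n)))

  first : PT (A ⊗ 𝕃 A) A (λ (x , xs) → headOr x xs)
  first .cmd = if tl %0 then (zero := hd (tl %0)) else (zero := hd %0)
  first .pol = K 7
  first .run (x , [])    s = _ , ⇓else refl ⇓:= , s≤s (s≤s (s≤s (s≤s (s≤s (s≤s z≤n)))))
  first .run (x , _ ∷ _) s = _ , ⇓then true ⇓:= , ≤-refl

  tagged₁ : PT A (A ⊕ B) inj₁
  tagged₁ = assign (cons nil %0) λ _ _ → refl

  tagged₂ : PT B (A ⊕ B) inj₂
  tagged₂ = assign (cons (cons nil nil) %0) λ _ _ → refl

  -- The extra variables of the given program become the variables 2, 3, …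
  fromProgram : ∀ A B {f} (c : Cmd (suc k)) (p : Pol) →
    (∀ x → ∃[ τ ] ∃[ t ] ⟨ c , enc A x ∷ replicate k nil ⟩⇓[ t ] τ × Vec.head τ ≡ enc B (f x) × t ≤ ⟦ p ⟧ (depthOf A x)) →
    PT A B f
  fromProgram _ _ c p r .cmd = rename (punchIn (suc zero)) c ⨾ rename suc (rename suc (clear k))
  fromProgram _ _ c p r .pol = p ⊞ K (clearTime k)
  fromProgram _ _ c p r .run x s with r x
  ... | o ∷ τ , t , ⇓c , refl , t≤ = _ ,
    ⇓⨾ (⇓-punchIn (suc zero) s ⇓c) (⇓-punchIn zero o (⇓-punchIn zero s (⇓clear τ))) ,
    +-monoˡ-≤ (clearTime k) t≤

  -- Iterating a polynomial-time function takes polynomial time if the depth of the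
  -- accumulator stays polynomial.
  fold : {z : Carrier E → Carrier A} {s : Carrier ((C ⊗ E) ⊗ A) → Carrier A} →
    PT E A z → PT ((C ⊗ E) ⊗ A) A s → (q : Pol) →
    (∀ xs e → depthOf A (foldl (λ a x → s ((x , e) , a)) (z e) xs) ≤ ⟦ q ⟧ (depthOf (𝕃 C ⊗ E) (xs , e))) →
    PT (𝕃 C ⊗ E) A (λ (xs , e) → foldl (λ a x → s ((x , e) , a)) (z e) xs)
  fold {E} {A} {C} {z} {s} Z S q growth = record { cmd = c ; pol = p ; run = r }
    where
    init : PT (𝕃 C ⊗ E) ((𝕃 C ⊗ E) ⊗ A) (λ (xs , e) → (xs , e) , z e)
    init = identity & (Z << π₂)

    -- The top of the stack holds the remaining list together with `e`; variable 0 holds the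
    -- accumulator.
    loop : Cmd (2 + k)
    loop = while hd (hd %1) loop
      ((zero := cons (cons (hd (hd (hd %1))) (tl (hd %1))) %0) ⨾
       (suc zero := cons (cons (tl (hd (hd %1))) (tl (hd %1))) (tl %1)) ⨾
       cmd S)

    c : Cmd (2 + k)
    c = cmd init ⨾ (suc zero := cons (hd %0) %1) ⨾ (zero := tl %0) ⨾ loop ⨾ (suc zero := tl %1)

    -- A pass costs 4 for the test, 11 and 12 for the two assignments, and the time of `S`; the
    -- failing test at the end costs 4.
    inner : Pol
    inner = 𝐱 ⊠ (K 27 ⊞ pol S ⊚ (K 1 ⊞ (𝐱 ⊞ q))) ⊞ K 4

    p : Pol
    p = pol init ⊞ (K 5 ⊞ (K 3 ⊞ (inner ⊞ K 3)))

    next : Carrier E → Carrier A → Carrier C → Carrier A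
    next e a x = s ((x , e) , a)

    -- The accumulators met by the loop are the folds of prefixes, hence the bound on all of these;
    -- `depth-prefix` later derives it from `growth`.
    r-loop : ∀ n b xs e a r → depthOf (𝕃 C ⊗ E) (xs , e) ≤ n →
      (∀ ys zs → ys ++ zs ≡ xs → depthOf A (foldl (next e) a ys) ≤ b) →
      ∃[ t ] ⟨ loop , store (enc A a) (enc (𝕃 C ⊗ E) (xs , e) ∙ r) ⟩⇓[ t ]
             store (enc A (foldl (next e) a xs)) (enc (𝕃 C ⊗ E) ([] , e) ∙ r) ×
             t ≤ length xs * (27 + ⟦ pol S ⟧ (suc (n + b))) + 4
    r-loop n b []       e a r xs≤n a≤b = _ , ⇓exit refl , ≤-refl
    r-loop n b (x ∷ xs) e a r xs≤n a≤b =
      let (t , ⇓c , t≤) = run S ((x , e) , a) (enc (𝕃 C ⊗ E) (xs , e) ∙ r)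
          (u , ⇓d , u≤) = r-loop n b xs e (next e a x) r
            (≤-trans (s≤s (⊔-monoˡ-≤ (depthOf E e) (m≤n⇒m≤1+n (m≤n⊔m (depthOf C x) _)))) xs≤n)
            (λ ys zs eq → a≤b (x ∷ ys) zs (cong (x ∷_) eq))
          x≤n = ≤-trans (s≤s (⊔-monoˡ-≤ (depthOf E e) (m≤n⇒m≤1+n (m≤m⊔n (depthOf C x) _)))) xs≤n
          t≤′ = ≤-trans t≤ (⟦⟧-mono (pol S) (s≤s (⊔-lub (≤-trans x≤n (m≤m+n n b)) (≤-trans (a≤b [] (x ∷ xs) refl) (m≤n+m b n)))))
      in _ , ⇓loop true (⇓⨾ ⇓:= (⇓⨾ ⇓:= ⇓c)) ⇓d ,
         +-monoʳ-≤ 27 (≤-trans (+-mono-≤ t≤′ u≤) (≤-reflexive (sym (+-assoc (⟦ pol S ⟧ (suc (n + b))) _ 4))))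

    r : ∀ x σ → _
    r (xs , e) σ =
      let n = depthOf (𝕃 C ⊗ E) (xs , e)
          (t , ⇓c , t≤) = run init (xs , e) σ
          (u , ⇓d , u≤) = r-loop n (⟦ q ⟧ n) xs e (z e) σ ≤-refl (λ ys zs eq →
            ≤-trans (growth ys e) (⟦⟧-mono q (s≤s (⊔-monoˡ-≤ (depthOf E e)
              (subst (λ xs → depthOf (𝕃 C) ys ≤ depthOf (𝕃 C) xs) eq (depth-prefix C ys zs))))))
          u≤′ = ≤-trans u≤ (+-monoˡ-≤ 4 (*-mono-≤
            (≤-trans (length≤depth C xs) (m≤n⇒m≤1+n (m≤m⊔n _ (depthOf E e))))
            (+-monoʳ-≤ 27 (⟦⟧-⊚ (pol S) (K 1 ⊞ (𝐱 ⊞ q)) ≤-refl))))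
      in _ , ⇓⨾ ⇓c (⇓⨾ ⇓:= (⇓⨾ ⇓:= (⇓⨾ ⇓d ⇓:=))) ,
         +-mono-≤ t≤ (+-monoʳ-≤ 8 (+-monoˡ-≤ 3 u≤′))

  -- If each step adds an amount that does not depend on the accumulator, the total growth is at
  -- most the length of the list times that amount.
  foldl-additive : {z : Carrier E → Carrier A} {s : Carrier ((C ⊗ E) ⊗ A) → Carrier A} →
    PT E A z → PT ((C ⊗ E) ⊗ A) A s → (q : Pol) →
    (∀ x e a → depthOf A (s ((x , e) , a)) ≤ ⟦ q ⟧ (depthOf (C ⊗ E) (x , e)) + depthOf A a) →
    PT (𝕃 C ⊗ E) A (λ (xs , e) → foldl (λ a x → s ((x , e) , a)) (z e) xs)
  foldl-additive {E} {A} {C} {z} {s} Z S q growth = fold Z S (𝐱 ⊠ q ⊞ out Z) λ xs e →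
    let n = depthOf (𝕃 C ⊗ E) (xs , e) in
    ≤-trans (bound e n (z e) xs ≤-refl)
      (+-mono-≤ (*-monoˡ-≤ (⟦ q ⟧ n) (≤-trans (length≤depth C xs) (m≤n⇒m≤1+n (m≤m⊔n _ (depthOf E e)))))
                (≤-trans (depth-out Z e) (⟦⟧-mono (out Z) (m≤n⇒m≤1+n (m≤n⊔m (depthOf (𝕃 C) xs) _)))))
    where
    bound : ∀ e n a xs → depthOf (𝕃 C ⊗ E) (xs , e) ≤ n →
            depthOf A (foldl (λ a x → s ((x , e) , a)) a xs) ≤ length xs * ⟦ q ⟧ n + depthOf A a
    bound e n a []       xs≤n = ≤-refl
    bound e n a (x ∷ xs) xs≤n = begin
      depthOf A (foldl _ (s ((x , e) , a)) xs)
        ≤⟨ bound e n _ xs (≤-trans (s≤s (⊔-monoˡ-≤ (depthOf E e) (m≤n⇒m≤1+n (m≤n⊔m (depthOf C x) _)))) xs≤n) ⟩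
      length xs * ⟦ q ⟧ n + depthOf A (s ((x , e) , a))
        ≤⟨ +-monoʳ-≤ (length xs * ⟦ q ⟧ n) (≤-trans (growth x e a) (+-monoˡ-≤ _ (⟦⟧-mono q
             (≤-trans (s≤s (⊔-monoˡ-≤ (depthOf E e) (m≤n⇒m≤1+n (m≤m⊔n (depthOf C x) _)))) xs≤n)))) ⟩
      length xs * ⟦ q ⟧ n + (⟦ q ⟧ n + depthOf A a)
        ≡⟨ +-assoc (length xs * ⟦ q ⟧ n) _ _ ⟨
      length xs * ⟦ q ⟧ n + ⟦ q ⟧ n + depthOf A a
        ≡⟨ cong (_+ depthOf A a) (+-comm (length xs * ⟦ q ⟧ n) _) ⟩
      length (x ∷ xs) * ⟦ q ⟧ n + depthOf A a ∎
      where open ≤-Reasoning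

  reversed : PT (𝕃 A) (𝕃 A) reverse
  reversed {A} = fold {E = 𝟙} {A = 𝕃 A} {C = A} (const []) (π₁ << π₁ ◂ π₂) (𝐱 ⊞ 𝐱)
      (λ xs _ → ≤-trans (depth-reverse A xs) (+-mono-≤ (m≤n⇒m≤1+n (m≤m⊔n _ 0)) (m≤n⇒m≤1+n (m≤m⊔n _ 0))))
    << (identity & const tt)

  foldr-additive : {z : Carrier E → Carrier A} {s : Carrier ((C ⊗ E) ⊗ A) → Carrier A} →
    PT E A z → PT ((C ⊗ E) ⊗ A) A s → (q : Pol) →
    (∀ x e a → depthOf A (s ((x , e) , a)) ≤ ⟦ q ⟧ (depthOf (C ⊗ E) (x , e)) + depthOf A a) →
    PT (𝕃 C ⊗ E) A (λ (xs , e) → foldr (λ x a → s ((x , e) , a)) (z e) xs)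
  foldr-additive {z = z} {s} Z S q growth =
    foldl-additive Z S q growth << (reversed << π₁ & π₂)
      ≗∶ λ (xs , e) → List.reverse-foldl (λ a x → s ((x , e) , a)) (z e) xs

  append : PT (𝕃 A ⊗ 𝕃 A) (𝕃 A) (λ (xs , ys) → xs ++ ys)
  append {A} = foldr-additive {E = 𝕃 A} {A = 𝕃 A} {C = A} identity (π₁ << π₁ ◂ π₂) (K 1 ⊞ 𝐱)
      (λ x e a → s≤s (≤-trans (m⊔n≤m+n (depthOf A x) _) (+-monoˡ-≤ _ (m≤n⇒m≤1+n (m≤m⊔n (depthOf A x) (depthOf (𝕃 A) e))))))
    ≗∶ λ (xs , ys) → sym (List.++-is-foldr xs ys)

  mapping : {f : Carrier (A ⊗ E) → Carrier B} → PT (A ⊗ E) B f → PT (𝕃 A ⊗ E) (𝕃 B) (λ (xs , e) → map (λ x → f (x , e)) xs)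
  mapping {A} {E} {B} {f} F = foldr-additive {E = E} {A = 𝕃 B} {C = A} (const []) (F << π₁ ◂ π₂) (K 1 ⊞ out F)
      (λ x e a → s≤s (≤-trans (m⊔n≤m+n (depthOf B (f (x , e))) _) (+-monoˡ-≤ _ (depth-out F (x , e)))))
    ≗∶ λ (xs , e) → sym (List.map-is-foldr xs)

  concatenation : PT (𝕃 (𝕃 A)) (𝕃 A) List.concat
  concatenation {A} = foldr-additive {E = 𝟙} {A = 𝕃 A} {C = 𝕃 A} (const []) (append << (π₁ << π₁ & π₂)) 𝐱
      (λ x e a → ≤-trans (depth-++ A x a) (+-monoˡ-≤ _ (m≤n⇒m≤1+n (m≤m⊔n (depthOf (𝕃 A) x) 0))))
    << (identity & const tt)

  fromUnary : PT 𝕌 (𝕃 𝟙) (λ n → List.replicate n tt)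
  fromUnary = recode eq
    where
    eq : ∀ n → encUnary n ≡ encList (enc 𝟙) (List.replicate n tt)
    eq zero    = refl
    eq (suc n) = cong (nil ∙_) (eq n)

  toUnary : PT (𝕃 𝟙) 𝕌 length
  toUnary = recode eq
    where
    eq : ∀ xs → encList (enc 𝟙) xs ≡ encUnary (length xs)
    eq []       = refl
    eq (_ ∷ xs) = cong (nil ∙_) (eq xs)

  lengthOf : PT (𝕃 A) 𝕌 length
  lengthOf = toUnary << mapping (const tt) << (identity & const {𝟙} tt) ≗∶ List.length-map _

  successor : PT 𝕌 𝕌 suc
  successor = assign (cons nil %0) λ _ _ → refl

  dropping : PT (𝕌 ⊗ 𝕃 A) (𝕃 A) (λ (n , xs) → drop n xs)
  dropping {A} = foldl-additive {E = 𝕃 A} {A = 𝕃 A} {C = 𝟙} identity (tail << π₂) (K 0)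
      (λ _ _ a → depth-drop A 1 a)
    << (fromUnary << π₁ & π₂) ≗∶ λ (n , xs) → eq n xs
    where
    eq : ∀ n xs → foldl (λ a _ → drop 1 a) xs (List.replicate n tt) ≡ drop n xs
    eq zero    xs       = refl
    eq (suc n) []       = trans (eq n []) (List.drop-[] n)
    eq (suc n) (x ∷ xs) = eq n xs

  monus : PT (𝕌 ⊗ 𝕌) 𝕌 (λ (m , n) → m ∸ n)
  monus = toUnary << dropping << (π₂ & fromUnary << π₁)
    ≗∶ λ (m , n) → trans (List.length-drop n (List.replicate m tt)) (cong (_∸ n) (List.length-replicate m))

  sumOf : PT (𝕌 ⊗ 𝕌) 𝕌 (λ (m , n) → m + n)
  sumOf = toUnary << append << (fromUnary << π₁ & fromUnary << π₂)
    ≗∶ λ (m , n) → trans (List.length-++ (List.replicate m tt)) (cong₂ _+_ (List.length-replicate m) (List.length-replicate n))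

  minimum : PT (𝕌 ⊗ 𝕌) 𝕌 (λ (m , n) → m ⊓ n)
  minimum = monus << (π₁ & monus) ≗∶ λ (m , n) → m∸[m∸n]≡m⊓n m n

  conjunction : {b c : Carrier A → Bool} → PT A 𝔹 b → PT A 𝔹 c → PT A 𝔹 (λ x → b x ∧ c x)
  conjunction {b = b} {c} F G = (If F Then G Else const false) ≗∶ eq
    where
    eq : ∀ x → (Bool.if b x then c x else false) ≡ b x ∧ c x
    eq x with b x
    ... | true  = refl
    ... | false = refl

  isZero : PT 𝕌 𝔹 (_≡ᵇ 0)
  isZero = isNull << fromUnary ≗∶ λ { zero → refl ; (suc _) → refl }

  isEqual : PT (𝕌 ⊗ 𝕌) 𝔹 (λ (m , n) → m ≡ᵇ n)
  isEqual = conjunction (isZero << monus) (isZero << monus << (π₂ & π₁)) ≗∶ λ (m , n) → eq m n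
    where
    eq : ∀ m n → (m ∸ n ≡ᵇ 0) ∧ (n ∸ m ≡ᵇ 0) ≡ (m ≡ᵇ n)
    eq zero    zero    = refl
    eq zero    (suc n) = refl
    eq (suc m) zero    = refl
    eq (suc m) (suc n) = eq m n

  entry : PT (A ⊗ 𝕃 A ⊗ 𝕌) A (λ (d , xs , n) → headOr d (drop n xs))
  entry = first << (π₁ & dropping << (π₂ << π₂ & π₁ << π₂))

-- Equality of letters

bits : ℕᵇ → List Bool
bits ℕᵇ.zero  = []
bits 2[1+ n ] = false ∷ bits n
bits 1+[2 n ] = true ∷ bits n

bits-injective : ∀ m n → bits m ≡ bits n → m ≡ n
bits-injective ℕᵇ.zero  ℕᵇ.zero  eq = refl
bits-injective 2[1+ m ] 2[1+ n ] eq = cong 2[1+_] (bits-injective m n (List.∷-injectiveʳ eq))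
bits-injective 1+[2 m ] 1+[2 n ] eq = cong 1+[2_] (bits-injective m n (List.∷-injectiveʳ eq))

eqBool : Bool → Bool → Bool
eqBool x y = Bool.if x then y else not y

eqBool-refl : ∀ x → eqBool x x ≡ true
eqBool-refl false = refl
eqBool-refl true  = refl

-- Letters can be too large for a unary comparison, so they are compared bit by bit. The state
-- records whether all bits agreed so far and what is left of the second list.
sameBit : Bool → Bool × List Bool → Bool × List Bool
sameBit x (ok , ys) = ok ∧ (not (null ys) ∧ eqBool x (headOr false ys)) , drop 1 ys

sameBits : List Bool → Bool × List Bool → Bool
sameBits xs a = let (ok , ys) = foldl (λ a x → sameBit x a) a xs in ok ∧ null ys

sameBits-false : ∀ xs ys → sameBits xs (false , ys) ≡ false
sameBits-false []       ys = refl
sameBits-false (x ∷ xs) ys = sameBits-false xs (drop 1 ys)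

sameBits-refl : ∀ xs → sameBits xs (true , xs) ≡ true
sameBits-refl []       = refl
sameBits-refl (x ∷ xs) = trans (cong (λ b → sameBits xs (b , xs)) (eqBool-refl x)) (sameBits-refl xs)

sameBits-sound : ∀ xs ys → sameBits xs (true , ys) ≡ true → xs ≡ ys
sameBits-sound []           []           eq = refl
sameBits-sound (x ∷ xs)     []           eq = contradiction (trans (sym eq) (sameBits-false xs [])) λ ()
sameBits-sound (false ∷ xs) (false ∷ ys) eq = cong (false ∷_) (sameBits-sound xs ys eq)
sameBits-sound (false ∷ xs) (true ∷ ys)  eq = contradiction (trans (sym eq) (sameBits-false xs ys)) λ ()
sameBits-sound (true ∷ xs)  (false ∷ ys) eq = contradiction (trans (sym eq) (sameBits-false xs ys)) λ ()
sameBits-sound (true ∷ xs)  (true ∷ ys)  eq = cong (true ∷_) (sameBits-sound xs ys eq)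

letterBits : Letter → List Bool
letterBits = bits ∘ ℕᵇ.fromℕ

-- Bijective binary has no leading zeros, so a number has only one bit list.
sameBits-≡ᵇ : ∀ a b → sameBits (letterBits a) (true , letterBits b) ≡ (a ≡ᵇ b)
sameBits-≡ᵇ a b with a ≡ᵇ b in a≡b
... | true rewrite ≡ᵇ-true {a} {b} a≡b = sameBits-refl (letterBits b)
... | false with sameBits (letterBits a) (true , letterBits b) in same
...   | false = refl
...   | true  = contradiction (fromℕ-injective (bits-injective _ _ (sameBits-sound (letterBits a) (letterBits b) same)))
                              (≡ᵇ-false {a} {b} a≡b)

𝕃𝕥𝕣 𝕎 𝕐 𝕊 𝕊𝕃ℙ ℝ𝕒𝕨 : Code
𝕃𝕥𝕣 = code encLetter
𝕎   = code encWord
𝕐   = 𝕌 ⊕ 𝕃𝕥𝕣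
𝕊   = 𝔹 ⊗ 𝕌 ⊗ 𝕌 ⊗ 𝕃 𝕐
𝕊𝕃ℙ = code encSLP
ℝ𝕒𝕨 = 𝕌 ⊗ 𝕃 (𝕃 𝕐)

relabel : ∀ {m} → Summary (Fin m ⊎ Letter) → Summary (ℕ ⊎ Letter)
relabel (b , p , q , u) = b , p , q , map (Sum.map₁ toℕ) u

-- Depth of summaries

depth-at : ∀ D n → depthOf 𝕃𝕥𝕣 (at D n) ≤ depthOf (𝕃 𝕃𝕥𝕣) D
depth-at []      n       = ≤-reflexive (cong (depthOf 𝕃𝕥𝕣 ∘ headOr 0) (List.drop-[] n))
depth-at (x ∷ D) zero    = m≤n⇒m≤1+n (m≤m⊔n _ _)
depth-at (x ∷ D) (suc n) = ≤-trans (depth-at D n) (m≤n⇒m≤1+n (m≤n⊔m (depthOf 𝕃𝕥𝕣 x) _))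

depth-middle-mul : ∀ D (m n : Summary (ℕ ⊎ Letter)) → depthOf (𝕃 𝕐) (middle (mul inj₂ D m n)) ≤
  3 + depthOf (𝕃 𝕃𝕥𝕣) D + depthOf (𝕃 𝕐) (middle m) + depthOf (𝕃 𝕐) (middle n)
depth-middle-mul D (true , p , q , u) (true , p′ , q′ , u′) = begin
  depthOf (𝕃 𝕐) (u ++ inj₂ a ∷ u′)
    ≤⟨ depth-++ 𝕐 u _ ⟩
  du + suc (suc (1 ⊔ depthOf 𝕃𝕥𝕣 a) ⊔ du′)
    ≤⟨ +-monoʳ-≤ du (s≤s (m⊔n≤m+n _ du′)) ⟩
  du + (suc (suc (1 ⊔ depthOf 𝕃𝕥𝕣 a)) + du′)
    ≤⟨ +-monoʳ-≤ du (+-monoˡ-≤ du′ (s≤s (s≤s (≤-trans (m⊔n≤m+n 1 _) (s≤s (depth-at D (q + p′))))))) ⟩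
  du + (3 + depthOf (𝕃 𝕃𝕥𝕣) D + du′)
    ≡⟨ +-assoc du _ du′ ⟨
  du + (3 + depthOf (𝕃 𝕃𝕥𝕣) D) + du′
    ≡⟨ cong (_+ du′) (+-comm du _) ⟩
  3 + depthOf (𝕃 𝕃𝕥𝕣) D + du + du′ ∎
  where
  open ≤-Reasoning
  a = at D (q + p′)
  du = depthOf (𝕃 𝕐) u
  du′ = depthOf (𝕃 𝕐) u′
depth-middle-mul D (true , p , q , u) (false , p′ , q′ , u′) =
  ≤-trans (m≤n+m _ (3 + depthOf (𝕃 𝕃𝕥𝕣) D)) (m≤m+n _ _)
depth-middle-mul D (false , p , q , u) (b , p′ , q′ , u′) = m≤n+m _ _

depth-summary : ∀ b p q u → depthOf 𝕊 (b , p , q , u) ≤ 4 + (p + q) + depthOf (𝕃 𝕐) u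
depth-summary b p q u = s≤s (⊔-lub (≤-trans (depth-bool b) (s≤s z≤n)) (s≤s (⊔-lub p≤ (s≤s (⊔-lub q≤ u≤)))))
  where
  depth-bool : ∀ b → depthOf 𝔹 b ≤ 1
  depth-bool false = z≤n
  depth-bool true  = ≤-refl
  p≤ : depthOf 𝕌 p ≤ 2 + (p + q) + depthOf (𝕃 𝕐) u
  p≤ = ≤-trans (≤-reflexive (depth-unary p)) (m≤n⇒m≤n+o _ (m≤n⇒m≤o+n 2 (m≤m+n p q)))
  q≤ : depthOf 𝕌 q ≤ 1 + (p + q) + depthOf (𝕃 𝕐) u
  q≤ = ≤-trans (≤-reflexive (depth-unary q)) (m≤n⇒m≤n+o _ (m≤n⇒m≤o+n 1 (m≤n+m q p)))
  u≤ : depthOf (𝕃 𝕐) u ≤ 1 + (p + q) + depthOf (𝕃 𝕐) u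
  u≤ = m≤n+m _ _

depth-middle : ∀ m → depthOf (𝕃 𝕐) (middle m) ≤ depthOf 𝕊 m
depth-middle (b , p , q , u) = ≤-trans (m≤n⊔m (depthOf 𝕌 q) _) (≤-trans (n≤1+n _)
  (≤-trans (m≤n⊔m (depthOf 𝕌 p) _) (≤-trans (n≤1+n _) (≤-trans (m≤n⊔m (depthOf 𝔹 b) _) (n≤1+n _)))))

depth-symSummary : ∀ (τ : ℕ → Summary (ℕ ⊎ Letter)) x → depthOf (𝕃 𝕐) (middle (symSummary τ x)) ≤ 1 + depthOf 𝕐 x
depth-symSummary τ (inj₁ X) with null (middle (τ X))
... | true  = z≤n
... | false = s≤s (≤-reflexive (⊔-identityʳ _))
depth-symSummary τ (inj₂ a) with a ≡ᵇ 1
... | true  = z≤n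
... | false = z≤n

-- The bound does not involve τ, hence the depth of the table does not accumulate
-- over the rounds.
depth-step : ∀ D (τ : ℕ → Summary (ℕ ⊎ Letter)) x m → let d = depthOf (𝕃 𝕃𝕥𝕣) D in
  depthOf 𝕊 (step D τ x m) ≤ (8 + (d + d + d) + depthOf 𝕐 x) + depthOf 𝕊 m
depth-step D τ x m = begin
  depthOf 𝕊 (step D τ x m)
    ≤⟨ depth-summary _ (length D ⊓ _) (length D ⊓ _) (middle (mul inj₂ D s m)) ⟩
  4 + (length D ⊓ _ + length D ⊓ _) + depthOf (𝕃 𝕐) (middle (mul inj₂ D s m))
    ≤⟨ +-mono-≤ (+-monoʳ-≤ 4 (+-mono-≤ (≤-trans (m⊓n≤m (length D) _) k≤d) (≤-trans (m⊓n≤m (length D) _) k≤d))) (depth-middle-mul D s m) ⟩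
  4 + (d + d) + (3 + d + depthOf (𝕃 𝕐) (middle s) + depthOf (𝕃 𝕐) (middle m))
    ≤⟨ +-monoʳ-≤ (4 + (d + d)) (+-mono-≤ (+-monoʳ-≤ (3 + d) (depth-symSummary τ x)) (depth-middle m)) ⟩
  4 + (d + d) + (3 + d + (1 + depthOf 𝕐 x) + depthOf 𝕊 m)
    ≡⟨ solve 3 (λ d x m → con 4 :+ (d :+ d) :+ (con 3 :+ d :+ (con 1 :+ x) :+ m) ⊜ (con 8 :+ (d :+ d :+ d) :+ x) :+ m) refl d (depthOf 𝕐 x) (depthOf 𝕊 m) ⟩
  (8 + (d + d + d) + depthOf 𝕐 x) + depthOf 𝕊 m ∎
  where
  open ≤-Reasoning
  open +-*-Solver using (solve; _:+_; con) renaming (_:=_ to _⊜_)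
  d = depthOf (𝕃 𝕃𝕥𝕣) D
  s = symSummary τ x
  k≤d : length D ≤ d
  k≤d = length≤depth 𝕃𝕥𝕣 D

depth-rhsSummary : ∀ D (τ : ℕ → Summary (ℕ ⊎ Letter)) xs {c} → let d = depthOf (𝕃 𝕃𝕥𝕣) D in
  (∀ {x} → x ∈ xs → depthOf 𝕐 x ≤ c) → depthOf 𝕊 (rhsSummary D τ xs) ≤ length xs * (8 + (d + d + d) + c) + 3
depth-rhsSummary D τ []       x≤c = ≤-refl
depth-rhsSummary D τ (x ∷ xs) {c} x≤c = ≤-trans (depth-step D τ x (rhsSummary D τ xs))
  (≤-trans (+-mono-≤ (+-monoʳ-≤ (8 + _) (x≤c (here refl))) (depth-rhsSummary D τ xs (x≤c ∘ there)))
  (≤-reflexive (sym (+-assoc (8 + (depthOf (𝕃 𝕃𝕥𝕣) D + depthOf (𝕃 𝕃𝕥𝕣) D + depthOf (𝕃 𝕃𝕥𝕣) D) + c) _ 3))))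

-- Decoding of encoded programs

look : List (Summary (ℕ ⊎ Letter)) → ℕ → Summary (ℕ ⊎ Letter)
look T X = headOr unit (drop X T)

Rules : Set
Rules = List (List (ℕ ⊎ Letter))

round : Rules → List Letter → List (Summary (ℕ ⊎ Letter)) → List (Summary (ℕ ⊎ Letter))
round P D T = map (rhsSummary D (look T)) P

-- The rules also serve as the loop counter, there being one for each nonterminal. The empty table
-- represents round zero because `look` returns `unit` beyond the end.
rounds : Rules → List Letter → List (Summary (ℕ ⊎ Letter))
rounds P D = foldl (λ T _ → round P D T) [] P

newRule : ℕ → List Letter → List (Summary (ℕ ⊎ Letter)) → ℕ → List (ℕ ⊎ Letter)
newRule S D T X = let (_ , p , _ , u) = look T X in
  Bool.if X ≡ᵇ S then inj₂ (at D p) ∷ u else (Bool.if null u then [ inj₂ 0 ] else u)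

range : ∀ {A : Set} → List A → List ℕ
range = foldr (λ _ ns → 0 ∷ map suc ns) []

decode : (ℕ × Rules) × List Letter → ℕ × Rules
decode ((S , P) , D) = S , map (newRule S D (rounds P D)) (range P)

encodeWord : Word → List Letter
encodeWord w = concatMap (encodeLetter (dedup (toList w))) (toList w)

module Programs (k : ℕ) where
  open Computable k

  private variable
    A : Code

  pt-bits : PT 𝕃𝕥𝕣 (𝕃 𝔹) letterBits
  pt-bits = recode λ a → eq (ℕᵇ.fromℕ a)
    where
    eq : ∀ n → encℕᵇ n ≡ encList encBool (bits n)
    eq ℕᵇ.zero  = refl
    eq 2[1+ n ] = cong (nil ∙_) (eq n)
    eq 1+[2 n ] = cong ((nil ∙ nil) ∙_) (eq n)

  negation : PT 𝔹 𝔹 not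
  negation = (If identity Then const false Else const true) ≗∶ λ { false → refl ; true → refl }

  pt-sameBit : PT ((𝔹 ⊗ 𝕃 𝔹) ⊗ 𝔹 ⊗ 𝕃 𝔹) (𝔹 ⊗ 𝕃 𝔹) (λ ((x , _) , a) → sameBit x a)
  pt-sameBit =
      conjunction (π₁ << π₂) (conjunction (negation << isNull << ys)
        (If π₁ << π₁ Then headBit Else negation << headBit))
    & tail << ys
    where
    ys = π₂ << π₂
    headBit = first << (const false & ys)

  pt-letterEq : PT (𝕃𝕥𝕣 ⊗ 𝕃𝕥𝕣) 𝔹 (λ (a , b) → a ≡ᵇ b)
  pt-letterEq = conjunction π₁ (isNull << π₂)
      << foldl-additive {E = 𝕃 𝔹} {A = 𝔹 ⊗ 𝕃 𝔹} {C = 𝔹} (const true & identity) pt-sameBit (K 1) growth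
      << (pt-bits << π₁ & pt-bits << π₂)
    ≗∶ λ (a , b) → sameBits-≡ᵇ a b
    where
    depth-bool : ∀ b → depthOf 𝔹 b ≤ 1
    depth-bool false = z≤n
    depth-bool true  = ≤-refl
    growth : ∀ x e a → depthOf (𝔹 ⊗ 𝕃 𝔹) (sameBit x a) ≤ 1 + depthOf (𝔹 ⊗ 𝕃 𝔹) a
    growth x e (ok , ys) = s≤s (⊔-lub (≤-trans (depth-bool (proj₁ (sameBit x (ok , ys)))) (s≤s z≤n))
      (m≤n⇒m≤1+n (≤-trans (depth-drop 𝔹 1 ys) (m≤n⊔m (depthOf 𝔹 ok) _))))

  pt-elem : PT (𝕃 𝕃𝕥𝕣 ⊗ 𝕃𝕥𝕣) 𝔹 (λ (D , a) → elem D a)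
  pt-elem = foldr-additive {E = 𝕃𝕥𝕣} {A = 𝔹} {C = 𝕃𝕥𝕣} (const false)
    (If pt-letterEq << π₁ Then const true Else π₂) (K 1) growth
    where
    growth : ∀ x e a → depthOf 𝔹 (Bool.if x ≡ᵇ e then true else a) ≤ 1 + depthOf 𝔹 a
    growth x e a with x ≡ᵇ e
    ... | true  = s≤s z≤n
    ... | false = n≤1+n _

  pt-dedup : PT (𝕃 𝕃𝕥𝕣) (𝕃 𝕃𝕥𝕣) dedup
  pt-dedup = foldr-additive {E = 𝟙} {A = 𝕃 𝕃𝕥𝕣} {C = 𝕃𝕥𝕣} (const [])
    (If pt-elem << (π₂ & π₁ << π₁) Then π₂ Else (π₁ << π₁ ◂ π₂)) (K 1 ⊞ 𝐱) growth << (identity & const tt)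
    where
    growth : ∀ x e a → depthOf (𝕃 𝕃𝕥𝕣) (Bool.if elem a x then a else x ∷ a) ≤ 1 + depthOf (𝕃𝕥𝕣 ⊗ 𝟙) (x , e) + depthOf (𝕃 𝕃𝕥𝕣) a
    growth x e a with elem a x
    ... | true  = m≤n+m _ _
    ... | false = s≤s (≤-trans (m⊔n≤m+n (depthOf 𝕃𝕥𝕣 x) _) (+-monoˡ-≤ (depthOf (𝕃 𝕃𝕥𝕣) a) (m≤n⇒m≤1+n (m≤m⊔n (depthOf 𝕃𝕥𝕣 x) 0))))

  pt-index : PT (𝕃 𝕃𝕥𝕣 ⊗ 𝕃𝕥𝕣) 𝕌 (λ (D , a) → index D a)
  pt-index = foldr-additive {E = 𝕃𝕥𝕣} {A = 𝕌} {C = 𝕃𝕥𝕣} (const 0)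
    (If pt-letterEq << π₁ Then const 0 Else successor << π₂) (K 1) growth
    where
    growth : ∀ x e n → depthOf 𝕌 (Bool.if x ≡ᵇ e then 0 else suc n) ≤ 1 + depthOf 𝕌 n
    growth x e n with x ≡ᵇ e
    ... | true  = z≤n
    ... | false = ≤-refl

  pt-encodeLetter : PT (𝕃𝕥𝕣 ⊗ 𝕃 𝕃𝕥𝕣) (𝕃 𝕃𝕥𝕣) (λ (a , D) → encodeLetter D a)
  pt-encodeLetter = append << (mapping (const 1) << (fromUnary << pt-index << (π₂ & π₁) & const {𝟙} tt) & const (2 ∷ []))
    ≗∶ λ (a , D) → cong (_++ [ 2 ]) (List.map-replicate _ (index D a) tt)

  pt-letters : PT 𝕎 (𝕃 𝕃𝕥𝕣) toList
  pt-letters = recode λ _ → refl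

  pt-encodeWord : PT 𝕎 (𝕃 𝕃𝕥𝕣) encodeWord
  pt-encodeWord = concatenation << mapping pt-encodeLetter << (pt-letters & pt-dedup << pt-letters)

  pt-at : PT (𝕃 𝕃𝕥𝕣 ⊗ 𝕌) 𝕃𝕥𝕣 (λ (D , n) → at D n)
  pt-at = entry << (const 0 & identity)

  twos : PT 𝕊 𝔹 proj₁
  twos = π₁

  leading : PT 𝕊 𝕌 (λ (_ , p , _ , _) → p)
  leading = π₁ << π₂

  trailing : PT 𝕊 𝕌 (λ (_ , _ , q , _) → q)
  trailing = π₁ << π₂ << π₂

  pt-middle : PT 𝕊 (𝕃 𝕐) middle
  pt-middle = π₂ << π₂ << π₂

  pt-mul : PT (𝕃 𝕃𝕥𝕣 ⊗ 𝕊 ⊗ 𝕊) 𝕊 (λ (D , m , n) → mul inj₂ D m n)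
  pt-mul = (If twos << l
      Then (If twos << r
        Then (const true & leading << l & trailing << r &
              append << (pt-middle << l & (tagged₂ << pt-at << (π₁ & gap) ◂ pt-middle << r)))
        Else (const true & leading << l & gap & pt-middle << l))
      Else (twos << r & sumOf << (leading << l & leading << r) & trailing << r & pt-middle << r))
    ≗∶ λ { (D , (true , _) , (true , _)) → refl ; (D , (true , _) , (false , _)) → refl ; (D , (false , _) , _) → refl }
    where
    l : PT (𝕃 𝕃𝕥𝕣 ⊗ 𝕊 ⊗ 𝕊) 𝕊 _
    l = π₁ << π₂
    r : PT (𝕃 𝕃𝕥𝕣 ⊗ 𝕊 ⊗ 𝕊) 𝕊 _
    r = π₂ << π₂
    gap : PT (𝕃 𝕃𝕥𝕣 ⊗ 𝕊 ⊗ 𝕊) 𝕌 _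
    gap = sumOf << (trailing << l & leading << r)

  pt-clamp : PT (𝕌 ⊗ 𝕊) 𝕊 (λ (k , m) → clamp k m)
  pt-clamp = twos << π₂ & minimum << (π₁ & leading << π₂) & minimum << (π₁ & trailing << π₂) & pt-middle << π₂

  pt-look : PT (𝕃 𝕊 ⊗ 𝕌) 𝕊 (λ (T , X) → look T X)
  pt-look = entry << (const unit & identity)

  pt-symSummary : PT (𝕐 ⊗ 𝕃 𝕊) 𝕊 (λ (x , T) → symSummary (look T) x)
  pt-symSummary = cases
      (twos << s & leading << s & trailing << s &
        (If isNull << pt-middle << s Then const [] Else (tagged₁ << π₁ ◂ const [])))
      (If pt-letterEq << (π₁ & const 1) Then const (false , 1 , 0 , []) Else const (true , 0 , 0 , []))
    ≗∶ λ { (inj₁ X , T) → refl ; (inj₂ a , T) → refl }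
    where
    s : PT (𝕌 ⊗ 𝕃 𝕊) 𝕊 _
    s = pt-look << (π₂ & π₁)

  pt-rhsSummary : PT (𝕃 𝕐 ⊗ 𝕃 𝕊 ⊗ 𝕃 𝕃𝕥𝕣) 𝕊 (λ (xs , T , D) → rhsSummary D (look T) xs)
  pt-rhsSummary = foldr-additive {E = 𝕃 𝕊 ⊗ 𝕃 𝕃𝕥𝕣} {A = 𝕊} {C = 𝕐} (const unit)
      (pt-clamp << (lengthOf << D & pt-mul << (D & pt-symSummary << (π₁ << π₁ & π₁ << π₂ << π₁) & π₂)))
      (K 8 ⊞ (𝐱 ⊞ 𝐱 ⊞ 𝐱) ⊞ 𝐱)
      growth
    where
    D : PT ((𝕐 ⊗ 𝕃 𝕊 ⊗ 𝕃 𝕃𝕥𝕣) ⊗ 𝕊) (𝕃 𝕃𝕥𝕣) _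
    D = π₂ << π₂ << π₁

    growth : ∀ x e m → depthOf 𝕊 (step (proj₂ e) (look (proj₁ e)) x m) ≤
      ⟦ K 8 ⊞ (𝐱 ⊞ 𝐱 ⊞ 𝐱) ⊞ 𝐱 ⟧ (depthOf (𝕐 ⊗ 𝕃 𝕊 ⊗ 𝕃 𝕃𝕥𝕣) (x , e)) + depthOf 𝕊 m
    growth x (T , D) m = ≤-trans (depth-step D (look T) x m) (+-monoˡ-≤ (depthOf 𝕊 m)
      (+-mono-≤ (+-monoʳ-≤ 8 (+-mono-≤ (+-mono-≤ d≤n d≤n) d≤n)) (m≤n⇒m≤1+n (m≤m⊔n (depthOf 𝕐 x) _))))
      where
      d≤n : depthOf (𝕃 𝕃𝕥𝕣) D ≤ depthOf (𝕐 ⊗ 𝕃 𝕊 ⊗ 𝕃 𝕃𝕥𝕣) (x , T , D)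
      d≤n = ≤-trans (≤-trans (m≤n⇒m≤1+n (m≤n⊔m (depthOf (𝕃 𝕊) T) _)) (m≤n⊔m (depthOf 𝕐 x) _)) (n≤1+n _)

  pt-rounds : PT (𝕃 (𝕃 𝕐) ⊗ 𝕃 𝕃𝕥𝕣) (𝕃 𝕊) (λ (P , D) → rounds P D)
  pt-rounds = fold {E = 𝕃 (𝕃 𝕐) ⊗ 𝕃 𝕃𝕥𝕣} {A = 𝕃 𝕊} {C = 𝕃 𝕐} (const [])
      (mapping pt-rhsSummary << (π₁ << π₂ << π₁ & π₂ & π₂ << π₂ << π₁))
      q growth << (π₁ & identity)
    where
    -- The number of rules plus the bound of `depth-rhsSummary`, with the length of a rule and the
    -- depths of dictionary and symbols all replaced by 𝐱.
    q : Pol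
    q = 𝐱 ⊞ (𝐱 ⊠ (K 8 ⊞ (𝐱 ⊞ 𝐱 ⊞ 𝐱) ⊞ 𝐱) ⊞ K 3)

    depth-round : ∀ P D T → depthOf (𝕃 𝕊) (round P D T) ≤ ⟦ q ⟧ (depthOf (𝕃 (𝕃 𝕐) ⊗ 𝕃 𝕃𝕥𝕣) (P , D))
    depth-round P D T = ≤-trans (depth-list 𝕊 (c * (8 + (c + c + c) + c) + 3) (round P D T) bound)
      (+-monoˡ-≤ _ (≤-trans (≤-reflexive (List.length-map _ P)) (≤-trans (length≤depth (𝕃 𝕐) P) P≤c)))
      where
      c = depthOf (𝕃 (𝕃 𝕐) ⊗ 𝕃 𝕃𝕥𝕣) (P , D)
      P≤c : depthOf (𝕃 (𝕃 𝕐)) P ≤ c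
      P≤c = m≤n⇒m≤1+n (m≤m⊔n _ (depthOf (𝕃 𝕃𝕥𝕣) D))
      D≤c : depthOf (𝕃 𝕃𝕥𝕣) D ≤ c
      D≤c = m≤n⇒m≤1+n (m≤n⊔m (depthOf (𝕃 (𝕃 𝕐)) P) _)
      bound : ∀ {m} → m ∈ round P D T → depthOf 𝕊 m ≤ c * (8 + (c + c + c) + c) + 3
      bound m∈ with ∈-map⁻ (rhsSummary D (look T)) m∈
      ... | xs , xs∈ , refl = ≤-trans
        (depth-rhsSummary D (look T) xs (λ x∈ → ≤-trans (depth-∈ 𝕐 x∈) (≤-trans (depth-∈ (𝕃 𝕐) xs∈) P≤c)))
        (+-monoˡ-≤ 3 (*-mono-≤
          (≤-trans (length≤depth 𝕐 xs) (≤-trans (depth-∈ (𝕃 𝕐) xs∈) P≤c))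
          (+-monoˡ-≤ c (+-monoʳ-≤ 8 (+-mono-≤ (+-mono-≤ D≤c D≤c) D≤c)))))

    growth : ∀ Q (e : Rules × List Letter) → depthOf (𝕃 𝕊) (foldl (λ T _ → round (proj₁ e) (proj₂ e) T) [] Q) ≤
      ⟦ q ⟧ (depthOf (𝕃 (𝕃 𝕐) ⊗ 𝕃 (𝕃 𝕐) ⊗ 𝕃 𝕃𝕥𝕣) (Q , e))
    growth Q (P , D) = ≤-trans (bounded [] Q z≤n) (⟦⟧-mono q (m≤n⇒m≤1+n (m≤n⊔m (depthOf (𝕃 (𝕃 𝕐)) Q) _)))
      where
      b = ⟦ q ⟧ (depthOf (𝕃 (𝕃 𝕐) ⊗ 𝕃 𝕃𝕥𝕣) (P , D))
      bounded : ∀ T (Q : Rules) → depthOf (𝕃 𝕊) T ≤ b → depthOf (𝕃 𝕊) (foldl (λ T _ → round P D T) T Q) ≤ b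
      bounded T []      T≤ = T≤
      bounded T (_ ∷ Q) T≤ = bounded (round P D T) Q (depth-round P D T)

  pt-newRule : PT (𝕌 ⊗ 𝕌 ⊗ 𝕃 𝕃𝕥𝕣 ⊗ 𝕃 𝕊) (𝕃 𝕐) (λ (X , S , D , T) → newRule S D T X)
  pt-newRule =
    If isEqual << (π₁ & π₁ << π₂)
    Then (tagged₂ << pt-at << (π₁ << π₂ << π₂ & leading << s) ◂ pt-middle << s)
    Else (If isNull << pt-middle << s Then const (inj₂ 0 ∷ []) Else pt-middle << s)
    where
    s : PT (𝕌 ⊗ 𝕌 ⊗ 𝕃 𝕃𝕥𝕣 ⊗ 𝕃 𝕊) 𝕊 _
    s = pt-look << (π₂ << π₂ << π₂ & π₁)

  pt-range : PT (𝕃 A) (𝕃 𝕌) range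
  pt-range {A} = foldr-additive {E = 𝟙} {A = 𝕃 𝕌} {C = A} (const [])
      (const 0 ◂ mapping {E = 𝟙} (successor << π₁) << (π₂ & const tt)) (K 2) growth << (identity & const tt)
    where
    depth-map-suc : ∀ ns → depthOf (𝕃 𝕌) (map suc ns) ≤ suc (depthOf (𝕃 𝕌) ns)
    depth-map-suc []       = z≤n
    depth-map-suc (n ∷ ns) = s≤s (⊔-lub (s≤s (m≤m⊔n _ _)) (≤-trans (depth-map-suc ns) (s≤s (m≤n⊔m (depthOf 𝕌 n) _))))
    growth : ∀ x e ns → depthOf (𝕃 𝕌) (0 ∷ map suc ns) ≤ 2 + depthOf (𝕃 𝕌) ns
    growth x e ns = s≤s (depth-map-suc ns)

  pt-decode : PT (ℝ𝕒𝕨 ⊗ 𝕃 𝕃𝕥𝕣) ℝ𝕒𝕨 decode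
  pt-decode = π₁ << π₁ &
    mapping pt-newRule << (pt-range << π₂ << π₁ & (π₁ << π₁ & π₂ & pt-rounds << (π₂ << π₁ & π₂)))

-- Numbering the nonterminals

mul-relabel : ∀ {N} D (m n : Summary (Fin N ⊎ Letter)) → mul inj₂ D (relabel m) (relabel n) ≡ relabel (mul inj₂ D m n)
mul-relabel D (true , p , q , u) (true , p′ , q′ , u′) = cong (λ v → true , p , q′ , v) (sym (List.map-++ (Sum.map₁ toℕ) u _))
mul-relabel D (true , p , q , u) (false , p′ , q′ , u′) = refl
mul-relabel D (false , p , q , u) (b , p′ , q′ , u′) = refl

module _ {N} {σ : ℕ → Summary (ℕ ⊎ Letter)} {τ : Fin N → Summary (Fin N ⊎ Letter)}
         (σ≡τ : ∀ X → σ (toℕ X) ≡ relabel (τ X)) where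

  symSummary-relabel : ∀ x → symSummary σ (Sum.map₁ toℕ x) ≡ relabel (symSummary τ x)
  symSummary-relabel (inj₁ X) = trans (cong (collapse (toℕ X)) (σ≡τ X)) (collapse-relabel (τ X))
    where
    collapse-relabel : ∀ m → collapse (toℕ X) (relabel m) ≡ relabel (collapse X m)
    collapse-relabel (b , p , q , [])    = refl
    collapse-relabel (b , p , q , _ ∷ _) = refl
  symSummary-relabel (inj₂ a) with a ≡ᵇ 1
  ... | true  = refl
  ... | false = refl

  rhsSummary-relabel : ∀ D xs → rhsSummary D σ (map (Sum.map₁ toℕ) xs) ≡ relabel (rhsSummary D τ xs)
  rhsSummary-relabel D []       = refl
  rhsSummary-relabel D (x ∷ xs) = trans
    (cong₂ (λ s m → clamp (length D) (mul inj₂ D s m)) (symSummary-relabel x) (rhsSummary-relabel D xs))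
    (cong (clamp (length D)) (mul-relabel D (symSummary τ x) (rhsSummary D τ xs)))

rawRule : ∀ {N} → List⁺ (Fin N ⊎ Letter) → List (ℕ ⊎ Letter)
rawRule = map (Sum.map₁ toℕ) ∘ toList

raw : SLP Letter → ℕ × Rules
raw 𝔸 = toℕ (start 𝔸) , map (rawRule ∘ prod 𝔸) (allFin (nonterminals 𝔸))

encList-map : ∀ {A B : Set} {e : B → Tree} {e′ : A → Tree} {f : A → B} → (∀ x → e′ x ≡ e (f x)) →
              ∀ xs → encList e′ xs ≡ encList e (map f xs)
encList-map eq []       = refl
encList-map eq (x ∷ xs) = cong₂ _∙_ (eq x) (encList-map eq xs)

enc-raw : ∀ 𝔸 → encSLP 𝔸 ≡ enc ℝ𝕒𝕨 (raw 𝔸)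
enc-raw 𝔸 = cong (encUnary (toℕ (start 𝔸)) ∙_)
  (encList-map (λ X → encList-map (λ { (inj₁ Y) → refl ; (inj₂ a) → refl }) (toList (prod 𝔸 X))) (allFin (nonterminals 𝔸)))

look-map : ∀ {N} (f : Fin N → Summary (ℕ ⊎ Letter)) X → look (map f (allFin N)) (toℕ X) ≡ f X
look-map f X = trans (cong (λ T → look T (toℕ X)) (List.map-tabulate id f)) (look-tabulate f X)
  where
  look-tabulate : ∀ {N} (f : Fin N → Summary (ℕ ⊎ Letter)) X → look (tabulate f) (toℕ X) ≡ f X
  look-tabulate f zero    = refl
  look-tabulate f (suc X) = look-tabulate (f ∘ suc) X

range≡ : ∀ {A : Set} {n} (xs : List A) → length xs ≡ n → range xs ≡ map toℕ (allFin n)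
range≡ xs refl = trans (range-tabulate xs) (sym (List.map-tabulate id toℕ))
  where
  range-tabulate : ∀ xs → range xs ≡ tabulate {n = length xs} toℕ
  range-tabulate []       = refl
  range-tabulate (x ∷ xs) = cong (0 ∷_) (trans (cong (map suc) (range-tabulate xs)) (List.map-tabulate toℕ suc))

module _ (𝔸 : SLP Letter) (D : List Letter) where
  open Decode 𝔸 D

  private
    P : Rules
    P = proj₂ (raw 𝔸)

    length-P : length P ≡ N
    length-P = trans (List.length-map _ (allFin N)) (List.length-tabulate {n = N} id)

  look-round : ∀ {t T} → (∀ X → look T (toℕ X) ≡ relabel (table t X)) →
               ∀ X → look (round P D T) (toℕ X) ≡ relabel (table (suc t) X)
  look-round {t} {T} eq X = begin
    look (round P D T) (toℕ X)
      ≡⟨ cong (λ T → look T (toℕ X)) (List.map-∘ (allFin N)) ⟨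
    look (map (rhsSummary D (look T) ∘ rawRule ∘ prod 𝔸) (allFin N)) (toℕ X)
      ≡⟨ look-map (rhsSummary D (look T) ∘ rawRule ∘ prod 𝔸) X ⟩
    rhsSummary D (look T) (rawRule (prod 𝔸 X))
      ≡⟨ rhsSummary-relabel eq D (rhs X) ⟩
    relabel (table (suc t) X) ∎
    where open ≡-Reasoning

  look-rounds : ∀ X → look (rounds P D) (toℕ X) ≡ relabel (τ X)
  look-rounds X = trans (iterate P 0 [] (λ X → cong (headOr unit) (List.drop-[] (toℕ X))) X)
    (cong (λ t → relabel (table t X)) (trans (+-identityʳ _) length-P))
    where
    iterate : ∀ (xs : Rules) t T → (∀ X → look T (toℕ X) ≡ relabel (table t X)) →
              ∀ X → look (foldl (λ T _ → round P D T) T xs) (toℕ X) ≡ relabel (table (length xs + t) X)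
    iterate []       t T eq X = eq X
    iterate (_ ∷ xs) t T eq X = trans (iterate xs (suc t) (round P D T) (look-round {t} eq) X)
      (cong (λ t → relabel (table t X)) (+-suc (length xs) t))

  newRule≡ : ∀ X → newRule (toℕ (start 𝔸)) D (rounds P D) (toℕ X) ≡ rawRule (rhs′ X)
  newRule≡ X rewrite look-rounds X = cases (toℕ X ≡ᵇ toℕ (start 𝔸)) (middle (τ X))
    where
    cases : ∀ b u {a} → (Bool.if b then inj₂ a ∷ map (Sum.map₁ toℕ) u else (Bool.if null (map (Sum.map₁ toℕ) u) then [ inj₂ 0 ] else map (Sum.map₁ toℕ) u))
              ≡ rawRule (Bool.if b then inj₂ a ∷ u else orJunk u)
    cases true  u       = refl
    cases false []      = refl
    cases false (x ∷ u) = refl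

  -- Identifies what the machine computes with the typed program, for which correctness and size are
  -- proved.
  decode-raw : decode (raw 𝔸 , D) ≡ raw 𝔻
  decode-raw = cong (toℕ (start 𝔸) ,_) (begin
    map (newRule (toℕ (start 𝔸)) D (rounds P D)) (range P)
      ≡⟨ cong (map _) (range≡ P length-P) ⟩
    map (newRule (toℕ (start 𝔸)) D (rounds P D)) (map toℕ (allFin N))
      ≡⟨ List.map-∘ (allFin N) ⟨
    map (newRule (toℕ (start 𝔸)) D (rounds P D) ∘ toℕ) (allFin N)
      ≡⟨ List.map-cong newRule≡ (allFin N) ⟩
    map (rawRule ∘ rhs′) (allFin N) ∎)
    where open ≡-Reasoning

-- Time bounds in terms of the size

size-letter : ∀ a → ∣ encLetter a ∣ᵗ ≤ 1 + 4 * depthOf 𝕃𝕥𝕣 a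
size-letter = binary ∘ ℕᵇ.fromℕ
  where
  bit : ∀ b d n → b ≤ 4 → n ≤ 1 + 4 * d → b + n ≤ 1 + 4 * suc d
  bit b d n b≤4 n≤ = ≤-trans (+-mono-≤ b≤4 n≤) (≤-reflexive (cong suc (sym (*-suc 4 d))))

  binary : ∀ n → ∣ encℕᵇ n ∣ᵗ ≤ 1 + 4 * depth (encℕᵇ n)
  binary ℕᵇ.zero  = ≤-refl
  binary 2[1+ n ] = bit 2 _ _ (s≤s (s≤s z≤n)) (binary n)
  binary 1+[2 n ] = ≤-trans (bit 4 _ _ ≤-refl (binary n))
    (+-monoʳ-≤ 1 (*-monoʳ-≤ 4 (s≤s (m≤n⊔m 1 (depth (encℕᵇ n))))))

wordSize : Pol
wordSize = K 1 ⊞ 𝐱 ⊠ (K 2 ⊞ K 4 ⊠ 𝐱)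

-- A tree can be exponentially larger than it is deep, but a word is a list of letters and a letter
-- a list of bits of bounded size. This turns the time bound of the given compressor, stated in
-- terms of size, into one in terms of depth.
size-word : ∀ w → ∣ encWord w ∣ᵗ ≤ ⟦ wordSize ⟧ (depthOf 𝕎 w)
size-word w = ≤-trans (letters (toList w) (depth-∈ 𝕃𝕥𝕣))
  (+-monoʳ-≤ 1 (*-monoˡ-≤ _ (length≤depth 𝕃𝕥𝕣 (toList w))))
  where
  letters : ∀ {d} as → (∀ {a} → a ∈ as → depthOf 𝕃𝕥𝕣 a ≤ d) → ∣ encList encLetter as ∣ᵗ ≤ 1 + length as * (2 + 4 * d)
  letters []           a≤d = ≤-refl
  letters {d} (a ∷ as) a≤d = s≤s (≤-trans
    (+-mono-≤ (≤-trans (size-letter a) (+-monoʳ-≤ 1 (*-monoʳ-≤ 4 (a≤d (here refl))))) (letters as (a≤d ∘ there)))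
    (≤-reflexive (+-suc (1 + 4 * d) _)))

fromPolyTime : ∀ {f : Word → SLP Letter} → PolyTime encWord encSLP f → ∃[ k ] Computable.PT k 𝕎 𝕊𝕃ℙ f
fromPolyTime {f} (P , a , d , b , run) = extra , Computable.fromProgram extra 𝕎 𝕊𝕃ℙ body bound λ w →
  let (τ , t , ⇓body , out , t≤) = run w in τ , t , ⇓body , out , ≤-trans t≤ (+-monoˡ-≤ b (*-monoʳ-≤ a (begin
    ∣ encWord w ∣ᵗ ^ d                    ≤⟨ ^-monoˡ-≤ d (size-word w) ⟩
    ⟦ wordSize ⟧ (depthOf 𝕎 w) ^ d        ≡⟨ ⟦^ₚ⟧ wordSize d _ ⟨
    ⟦ wordSize ^ₚ d ⟧ (depthOf 𝕎 w)       ∎)))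
  where
  open Program P
  open ≤-Reasoning
  bound : Pol
  bound = K a ⊠ wordSize ^ₚ d ⊞ K b

toPolyTime : ∀ {k A B f} → Computable.PT k A B f → PolyTime (enc A) (enc B) f
toPolyTime {k} {A} F with monomial-bound (Computable.PT.pol F)
-- The stack becomes one more extra variable and is initially nil.
... | a , d , pol≤ = record { extra = suc k ; body = cmd } , a , d , 0 , λ x →
  let (t , ⇓cmd , t≤) = run x nil in
  _ , t , ⇓cmd , refl , ≤-trans t≤ (≤-trans (bound (enc A x)) (m≤m+n _ 0))
  where
  open Computable.PT F
  bound : ∀ s → ⟦ pol ⟧ (depth s) ≤ a * ∣ s ∣ᵗ ^ d
  bound nil     = ≤-trans (⟦⟧-mono pol z≤n) (pol≤ _)
  bound (s ∙ u) = ≤-trans (⟦⟧-mono pol (<⇒≤ (depth<size (s ∙ u)))) (pol≤ _)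

-- The compressor

-- The default only satisfies the type: every letter contributes a nonempty block, so an encoded
-- word is never empty.
nonempty : List Letter → Word
nonempty []      = 2 ∷ []
nonempty (a ∷ v) = a ∷ v

encoded : Word → Word
encoded = nonempty ∘ encodeWord

toList-encoded : ∀ w → toList (encoded w) ≡ encodeWord w
toList-encoded (a ∷ w) = toList-nonempty (index (dedup (a ∷ w)) a)
  where
  toList-nonempty : ∀ n {v} → let u = (List.replicate n 1 ++ [ 2 ]) ++ v in toList (nonempty u) ≡ u
  toList-nonempty zero    = refl
  toList-nonempty (suc n) = refl

encoded-binary : ∀ w → encoded w ∈[1, 2 ]^ List⁺.length (encoded w)
encoded-binary w = subst (All _) (sym (toList-encoded w)) (All.concat⁺ (All.map⁺ (All.universal block (toList w)))) , refl
  where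
  block : ∀ a → All (λ b → 1 ≤ b × b ≤ 2) (encodeLetter (dedup (toList w)) a)
  block a = All.++⁺ (All.replicate⁺ _ (s≤s z≤n , s≤s z≤n)) ((s≤s z≤n , ≤-refl) ∷ [])

module _ (𝒞 : Compressor) where

  binaryToGeneral : Compressor
  binaryToGeneral .compress w = Decode.𝔻 (compress 𝒞 (encoded w)) (dedup (toList w))
  binaryToGeneral .correct (a ∷ w) = Decode.decode-correct (compress 𝒞 (encoded (a ∷ w))) (dedup (a ∷ w)) a w
    (∈-dedup⁺ (a ∷ w)) (trans (correct 𝒞 (encoded (a ∷ w))) (toList-encoded (a ∷ w)))

  polynomialTime : IsPolynomialTime 𝒞 → IsPolynomialTime binaryToGeneral
  polynomialTime poly = let (k , F) = fromPolyTime poly in toPolyTime (computes k F)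
    where
    computes : ∀ k → Computable.PT k 𝕎 𝕊𝕃ℙ (compress 𝒞) → Computable.PT k 𝕎 𝕊𝕃ℙ (compress binaryToGeneral)
    computes k F = retarget (pt-decode << (pt-raw << F << pt-encoded & pt-dedup << pt-letters)) λ w →
        trans (cong (enc ℝ𝕒𝕨) (decode-raw (compress 𝒞 (encoded w)) (dedup (toList w)))) (sym (enc-raw (compress binaryToGeneral w)))
      where
      open Computable k
      open Programs k
      pt-raw : PT 𝕊𝕃ℙ ℝ𝕒𝕨 raw
      pt-raw = recode enc-raw
      pt-encoded : PT 𝕎 𝕎 encoded
      pt-encoded = retarget pt-encodeWord (cong (encList encLetter) ∘ sym ∘ toList-encoded)

-- Approximation ratios

open import Data.Integer.Base using (+_)

-- An upper bound on a real is a negation, so that for proving it a smallest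
-- program may be assumed to exist.
¬¬smallest : ∀ w 𝔸 → Produces 𝔸 w → ¬ ¬ (∃[ m ] m ≤ size 𝔸 × IsSmallestSize w m)
¬¬smallest w 𝔸 produces none = <-rec (λ n → ∀ 𝔹 → Produces 𝔹 w → size 𝔹 ≤ size 𝔸 → size 𝔹 ≡ n → ⊥) descend _ 𝔸 produces ≤-refl refl
  where
  descend : ∀ n → (∀ {m} → m < n → ∀ 𝔹 → Produces 𝔹 w → size 𝔹 ≤ size 𝔸 → size 𝔹 ≡ m → ⊥) →
            ∀ 𝔹 → Produces 𝔹 w → size 𝔹 ≤ size 𝔸 → size 𝔹 ≡ n → ⊥
  descend _ rec 𝔹 𝔹-produces 𝔹≤𝔸 refl = none (size 𝔹 , 𝔹≤𝔸 , (𝔹 , 𝔹-produces , refl) , λ ℂ ℂ-produces →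
    ≮⇒≥ λ ℂ<𝔹 → rec ℂ<𝔹 ℂ ℂ-produces (≤-trans (<⇒≤ ℂ<𝔹) 𝔹≤𝔸) refl)

size-nonZero : ∀ (𝔸 : SLP Letter) → NonZero (size 𝔸)
size-nonZero 𝔸 with nonterminals 𝔸 | start 𝔸 | prod 𝔸
... | suc _ | _ | _ = _

-- s/(6g) ≤ 2s′/(6g) = s′/(3g) ≤ s′/g′. The factor stands on the left as a division by 6 because the
-- cut of `(+ 6 / 1) · c` at q is by definition the cut of `c` at q/6.
sixth≤ : ∀ s g s′ g′ .{{_ : NonZero g}} .{{_ : NonZero g′}} → s ≤ s′ + s′ → g′ ≤ 3 * g →
         (+ s / g) ℚ.* 1/ (+ 6 / 1) ℚ.≤ + s′ / g′
sixth≤ s (suc g) s′ (suc g′) s≤ g′≤ = ℚ.toℚᵘ-cancel-≤ (begin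
  toℚᵘ ((+ s / suc g) ℚ.* 1/ (+ 6 / 1))
    ≃⟨ ℚ.toℚᵘ-homo-* (+ s / suc g) (1/ (+ 6 / 1)) ⟩
  toℚᵘ (+ s / suc g) ℚᵘ.* mkℚᵘ (+ 1) 5
    ≃⟨ ℚᵘ.*-congʳ (ℚ.toℚᵘ-fromℚᵘ (mkℚᵘ (+ s) g)) ⟩
  mkℚᵘ (+ s) g ℚᵘ.* mkℚᵘ (+ 1) 5
    ≤⟨ ℚᵘ.*≤* (subst₂ ℤ._≤_ (trans (ℤ.pos-* (s * 1) (suc g′)) (cong (ℤ._* + suc g′) (ℤ.pos-* s 1))) (ℤ.pos-* s′ (suc g * 6)) (ℤ.+≤+ cross)) ⟩
  mkℚᵘ (+ s′) g′
    ≃⟨ ℚ.toℚᵘ-fromℚᵘ (mkℚᵘ (+ s′) g′) ⟨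
  toℚᵘ (+ s′ / suc g′) ∎)
  where
  open ℚᵘ.≤-Reasoning
  cross : s * 1 * suc g′ ≤ s′ * (suc g * 6)
  cross = ≤-trans (*-mono-≤ (≤-reflexive (*-identityʳ s)) ≤-refl) (≤-trans (*-mono-≤ s≤ g′≤)
    (≤-reflexive (solve 2 (λ s g → (s :+ s) :* (con 3 :* g) ⊜ s :* (g :* con 6)) refl s′ (suc g))))
    where open +-*-Solver using (solve; _:+_; _:*_; con) renaming (_:=_ to _⊜_)

U-mono : ∀ (x : ℝ) {p q} → p ℚ.≤ q → ℝ.U x p → ℝ.U x q
U-mono x {p} {q} p≤q u with ℚ.<-cmp p q
... | tri< p<q _ _  = ℝ.U-up x p<q u
... | tri≈ _ refl _ = u
... | tri> _ _ q<p  = ⊥-elim (ℚ.<-irrefl refl (ℚ.<-≤-trans q<p p≤q))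

-- A ratio above 6c for w forces a ratio above c for the encoded word, against the hypothesis taken
-- at the length of that word.
ratio≤6c : ∀ c 𝒞 → (∀ n → α[ 𝒞 ][ 2 , n ]≤ c) → ∀ k n → α[ binaryToGeneral 𝒞 ][ k , n ]≤ (+ 6 / 1) · c
ratio≤6c c 𝒞 α≤c k n r (w@(a ∷ v) , _ , g , ((𝔸 , produces , refl) , _) , g≢0 , refl) r>6c =
  let (𝔼 , val-𝔼 , size-𝔼) = encode 𝔸 a v produces in
  ¬¬smallest (encoded w) 𝔼 (trans val-𝔼 (sym (toList-encoded w))) λ where
    (m , m≤𝔼 , smallest@((𝔹 , _ , refl) , _)) →
      let m≢0 = size-nonZero 𝔹 in
      α≤c _ _ (encoded w , encoded-binary w , m , smallest , m≢0 , refl)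
        (U-mono c (sixth≤ (size (compress (binaryToGeneral 𝒞) w)) (size 𝔸) (size (compress 𝒞 (encoded w))) m {{g≢0}} {{m≢0}}
          (Decode.decode-size (compress 𝒞 (encoded w)) (dedup (toList w))) (≤-trans m≤𝔼 size-𝔼)) r>6c)

theorem3p8 : (c : ℝ) → 1ℚ ≤ʳ c →
    (∃[ 𝒞 ] IsPolynomialTime 𝒞 × (∀ n → α[ 𝒞 ][ 2 , n ]≤ c)) →
    (∃[ 𝒟 ] IsPolynomialTime 𝒟 × (∀ n → α[ 𝒟 ][ n , n ]≤ (+ 6 / 1) · c))
theorem3p8 c _ (𝒞 , poly , α≤c) = binaryToGeneral 𝒞 , polynomialTime 𝒞 poly , λ n → ratio≤6c c 𝒞 α≤c n n
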